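{- Fix an integer $n\ge 3$. There exist constants $C=C(n)<\infty$ and $\theta=\theta(n)\in(0,1)$, independent of $m$, such that for every integer $m\ge 2$ and every integer $\ell\ge 1$, the uniform spanning tree $T$ of the wired cylindrical graph $G_{n,m}^{\mathrm s}$ satisfies $$\mathbb P\bigl(\exists\text{ a sink-trunk }L\subset T\text{ such that every branch off }L\text{ has length}<\ell\bigr)\;\ge\;1-C\,m^3\,\theta^{\ell}.$$
   Context: For $n\ge 3$, $m\ge 2$, the cylindrical graph $G_{n,m}=C_n\times P_m$ has vertex set $\{(i,j): i\in\mathbb{Z}_n,\ j\in\{0,\dots,m-1\}\}$ and edges $\{(i,j),(i+1,j)\}$ ($i\in\mathbb{Z}_n$, $0\le j\le m-1$) and $\{(i,j),(i,j+1)\}$ ($i\in\mathbb{Z}_n$, $0\le j\le m-2$). Its rings are $R_k=\{(i,k): i\in\mathbb{Z}_n\}$, $k=0,\dots,m-1$. The wired cylindrical graph $G_{n,m}^{\mathrm s}$ is obtained from $G_{n,m}$ by adding one new vertex $s$ (the sink) and the edges $\{s,v\}$ for all $v\in R_0\cup R_{m-1}$. A uniform spanning tree of a finite connected graph is a spanning tree chosen uniformly among all its spanning trees. A trunk of a spanning tree $T$ of $G_{n,m}^{\mathrm s}$ is a simple path $L\subset T$ with $L\cap R_k\neq\varnothing$ for every $k=0,\dots,m-1$; a sink-trunk is a trunk $L\subset T$ with $s\in L$. Given a trunk $L\subset T$, every connected component $B$ of $T\setminus V(L)$ is adjacent in $T$ to a unique vertex $a(B)\in V(L)$; the corresponding branch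 off $L$ is the subtree induced by $V(B)\cup\{a(B)\}$, and its length is $\max_{v\in V(B)} d_T(v,a(B))$, where $d_T$ is the graph distance in $T$. -}

module Defs where

open import Data.Empty using (⊥)
open import Data.Fin.Base using (Fin; toℕ; inject₁; fromℕ) renaming (zero to fzero; suc to fsuc)
import Data.Fin.Properties as Fin
open import Data.Fin.Subset using (Subset; inside; outside) renaming (_∈_ to _∈ₛ_)
import Data.Fin.Subset.Properties as Subset
open import Data.Integer.Base using (+_)
open import Data.List.Base
  using (List; []; _∷_; _++_; _∷ʳ_; map; filter; length; lookup; head; last; upTo; allFin;
         cartesianProduct; cartesianProductWith)
import Data.List.Extrema.Nat as Extrema
import Data.List.Membership.DecPropositional as DecMembership
open import Data.List.Membership.Propositional using (_∈_; _∉_; find; lose)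
open import Data.List.Membership.Propositional.Properties
  using (∈-map⁺; ∈-allFin; ∈-lookup; ∈-cartesianProduct⁺; ∈-cartesianProductWith⁺)
open import Data.List.Relation.Unary.All as All using ([]; _∷_)
open import Data.List.Relation.Unary.All.Properties using (¬Any⇒All¬)
open import Data.List.Relation.Unary.AllPairs using ([]; _∷_)
open import Data.List.Relation.Unary.Any as Any using (here; there)
import Data.List.Relation.Unary.Any.Properties as Any
open import Data.List.Relation.Unary.Linked using (Linked; []; [-]; _∷_; linked?)
open import Data.List.Relation.Unary.Unique.Propositional using (Unique)
import Data.List.Relation.Unary.Unique.DecPropositional as DecUnique
open import Data.Maybe.Base using (Maybe; just; nothing)
import Data.Maybe.Properties as Maybe
open import Data.Nat.Base using (ℕ; zero; suc; _≤_; _<_; z≤n; s≤s)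
open import Data.Nat.DivMod using (_mod_)
open import Data.Nat.Properties using (_≤?_; _<?_)
open import Data.Product.Base using (∃; _×_; _,_)
import Data.Product.Properties as Product
open import Data.Rational.Base using (ℚ; 0ℚ; _/_)
open import Data.Sum.Base using (_⊎_)
open import Data.Vec.Base using ([]; _∷_)
open import Relation.Binary.Construct.Closure.ReflexiveTransitive using (Star; ε; _◅_)
open import Relation.Binary.Core using (Rel)
open import Relation.Binary.Definitions using (DecidableEquality) renaming (Decidable to Decidable₂)
open import Relation.Binary.PropositionalEquality using (_≡_; refl; sym; trans; cong)
open import Relation.Nullary using (¬_; Dec; yes; no; contradiction)
open import Relation.Nullary.Decidable using (map′; ¬?; _×-dec_; _⊎-dec_; _→-dec_)
open import Relation.Unary using (Pred; Decidable)
open import Level using (0ℓ)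

-- Uniform probability of P on a list; the list should be free of repetitions.
-- The value on the empty list is a convention.
Pr : {A : Set} → List A → {P : Pred A 0ℓ} → Decidable P → ℚ
Pr []           P? = 0ℚ
Pr xs@(_ ∷ _) P? = + length (filter P? xs) / length xs

subsets : ∀ k → List (Subset k)
subsets zero    = [] ∷ []
subsets (suc k) = map (outside ∷_) (subsets k) ++ map (inside ∷_) (subsets k)

-- Edges are unordered: (u , v) joins u and v in both directions. The graphs
-- here are simple, so the edge list should have no loops and should not
-- list an unordered pair twice.
record Graph : Set₁ where
  field
    V                 : Set
    _≟_               : DecidableEquality V
    vertices          : List V
    vertices-complete : ∀ v → v ∈ vertices
    edges             : List (V × V)

  -- A spanning subgraph, given by its set of edges.
  Subgraph : Set
  Subgraph = Subset (length edges)

open Graph using (V; Subgraph)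

module _ (G : Graph) where
  open Graph G hiding (V; Subgraph)
  open DecMembership _≟_ using (_∈?_; _∉?_)

  any-vertex? : {P : Pred (V G) 0ℓ} → Decidable P → Dec (∃ P)
  any-vertex? P? =
    map′ (λ a → let v , _ , p = find a in v , p)
         (λ (v , p) → lose (vertices-complete v) p)
         (Any.any? P? vertices)

  all-vertices? : {P : Pred (V G) 0ℓ} → Decidable P → Dec (∀ v → P v)
  all-vertices? P? =
    map′ (λ a v → All.lookup a (vertices-complete v))
         (λ f → All.universal f vertices)
         (All.all? P? vertices)

  lists≤ : ℕ → List (List (V G))
  lists≤ zero    = [] ∷ []
  lists≤ (suc k) = [] ∷ cartesianProductWith _∷_ vertices (lists≤ k)

  ∈-lists≤ : ∀ {k} (p : List (V G)) → length p ≤ k → p ∈ lists≤ k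
  ∈-lists≤ {zero}  []      z≤n       = here refl
  ∈-lists≤ {suc k} []      z≤n       = here refl
  ∈-lists≤ {suc k} (x ∷ p) (s≤s p≤k) =
    there (∈-cartesianProductWith⁺ _∷_ (vertices-complete x) (∈-lists≤ p p≤k))

  lookup-injective : ∀ {p : List (V G)} → Unique p →
                     ∀ i j → lookup p i ≡ lookup p j → i ≡ j
  lookup-injective (x∉ ∷ u) fzero    fzero    eq = refl
  lookup-injective (x∉ ∷ u) fzero    (fsuc j) eq =
    contradiction eq (All.lookup x∉ (∈-lookup j))
  lookup-injective (x∉ ∷ u) (fsuc i) fzero    eq =
    contradiction (sym eq) (All.lookup x∉ (∈-lookup i))
  lookup-injective (x∉ ∷ u) (fsuc i) (fsuc j) eq =
    cong fsuc (lookup-injective u i j eq)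

  Unique⇒length≤ : ∀ {p : List (V G)} → Unique p → length p ≤ length vertices
  Unique⇒length≤ {p} u = Fin.injective⇒≤ {f = position} position-injective
    where
    position : Fin (length p) → Fin (length vertices)
    position i = Any.index (vertices-complete (lookup p i))

    position-injective : ∀ {i j} → position i ≡ position j → i ≡ j
    position-injective {i} {j} eq = lookup-injective u i j
      (trans (Any.lookup-index (vertices-complete (lookup p i)))
      (trans (cong (lookup vertices) eq)
             (sym (Any.lookup-index (vertices-complete (lookup p j))))))

  any-unique-list? : {P : Pred (List (V G)) 0ℓ} → Decidable P →
                     Dec (∃ λ p → Unique p × P p)
  any-unique-list? P? =
    map′ (λ a → let p , _ , uP = find a in p , uP)
         (λ (p , u , Pp) → lose (∈-lists≤ p (Unique⇒length≤ u)) (u , Pp))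
         (Any.any? (λ p → DecUnique.unique? _≟_ p ×-dec P? p) (lists≤ (length vertices)))

  Joins : Rel (V G) 0ℓ → V G → V G → Pred (List (V G)) 0ℓ
  Joins R u v p = head p ≡ just u × last p ≡ just v × Linked R p

  joins⇒star : {R : Rel (V G) 0ℓ} {u v : V G} (p : List (V G)) → Joins R u v p → Star R u v
  joins⇒star (x ∷ [])    (refl , refl , _)     = ε
  joins⇒star (x ∷ y ∷ p) (refl , eq , r ∷ rs)  = r ◅ joins⇒star (y ∷ p) (refl , eq , rs)

  cut : {R : Rel (V G) 0ℓ} {v u : V G} {p : List (V G)} → u ∈ p → Unique p →
        last p ≡ just v → Linked R p → ∃ λ q → Unique q × Joins R u v q
  cut {p = _ ∷ _}     (here refl) un       eq rs       = _ , un , refl , eq , rs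
  cut {p = _ ∷ _ ∷ _} (there u∈)  (_ ∷ un) eq (_ ∷ rs) = cut u∈ un eq rs

  star⇒joins : {R : Rel (V G) 0ℓ} {u v : V G} → Star R u v → ∃ λ p → Unique p × Joins R u v p
  star⇒joins ε = _ ∷ [] , [] ∷ [] , refl , refl , [-]
  star⇒joins {u = u} (r ◅ s) with star⇒joins s
  ... | p@(_ ∷ _) , un , refl , eq , rs with u ∈? p
  ...   | yes u∈p = cut u∈p un eq rs
  ...   | no  u∉p = u ∷ p , ¬Any⇒All¬ p u∉p ∷ un , refl , eq , r ∷ rs

  star? : {R : Rel (V G) 0ℓ} → Decidable₂ R → Decidable₂ (Star R)
  star? R? u v =
    map′ (λ (p , _ , j) → joins⇒star p j) star⇒joins
         (any-unique-list? (λ p →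
           Maybe.≡-dec _≟_ (head p) (just u) ×-dec
           (Maybe.≡-dec _≟_ (last p) (just v) ×-dec linked? R? p)))

  Adjacent : Subgraph G → Rel (V G) 0ℓ
  Adjacent T u v =
    ∃ λ e → e ∈ₛ T × (lookup edges e ≡ (u , v) ⊎ lookup edges e ≡ (v , u))

  adjacent? : ∀ T → Decidable₂ (Adjacent T)
  adjacent? T u v = Fin.any? λ e →
    e Subset.∈? T ×-dec
    (Product.≡-dec _≟_ _≟_ (lookup edges e) (u , v) ⊎-dec
     Product.≡-dec _≟_ _≟_ (lookup edges e) (v , u))

  Connected : Pred (Subgraph G) 0ℓ
  Connected T = ∀ u v → Star (Adjacent T) u v

  connected? : Decidable Connected
  connected? T = all-vertices? λ u → all-vertices? λ v → star? (adjacent? T) u v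

  -- The cycle through v ∷ vs returns from its last vertex to v.
  Closed : Subgraph G → Pred (List (V G)) 0ℓ
  Closed T []       = ⊥
  Closed T (v ∷ vs) = 2 ≤ length vs × Linked (Adjacent T) (v ∷ vs ∷ʳ v)

  closed? : ∀ T → Decidable (Closed T)
  closed? T []       = no λ ()
  closed? T (v ∷ vs) = 2 ≤? length vs ×-dec linked? (adjacent? T) (v ∷ vs ∷ʳ v)

  Acyclic : Pred (Subgraph G) 0ℓ
  Acyclic T = ¬ ∃ λ c → Unique c × Closed T c

  acyclic? : Decidable Acyclic
  acyclic? T = ¬? (any-unique-list? (closed? T))

  IsSpanningTree : Pred (Subgraph G) 0ℓ
  IsSpanningTree T = Connected T × Acyclic T

  isSpanningTree? : Decidable IsSpanningTree
  isSpanningTree? T = connected? T ×-dec acyclic? T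

  spanningTrees : List (Subgraph G)
  spanningTrees = filter isSpanningTree? (subsets (length edges))

  Walk : Subgraph G → ℕ → Rel (V G) 0ℓ
  Walk T zero    u v = u ≡ v
  Walk T (suc k) u v = ∃ λ w → Adjacent T u w × Walk T k w v

  walk? : ∀ T k → Decidable₂ (Walk T k)
  walk? T zero    u v = u ≟ v
  walk? T (suc k) u v = any-vertex? λ w → adjacent? T u w ×-dec walk? T k w v

  -- A shortest walk repeats no vertex, so has fewer than |V| edges. The value
  -- |V| stands for an infinite distance.
  dist : Subgraph G → V G → V G → ℕ
  dist T u v =
    Extrema.min (length vertices) (filter (λ k → walk? T k u v) (upTo (length vertices)))

  -- A simple path is given by its vertices in order.
  IsSimplePath : Subgraph G → Pred (List (V G)) 0ℓ
  IsSimplePath T L = Unique L × Linked (Adjacent T) L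

  AdjacentOutside : Subgraph G → List (V G) → Rel (V G) 0ℓ
  AdjacentOutside T L u v = u ∉ L × v ∉ L × Adjacent T u v

  adjacentOutside? : ∀ T L → Decidable₂ (AdjacentOutside T L)
  adjacentOutside? T L u v = u ∉? L ×-dec (v ∉? L ×-dec adjacent? T u v)

  -- For u ∉ L, the vertices v with SameComponent T L u v form the connected
  -- component of u in T ∖ L.
  SameComponent : Subgraph G → List (V G) → Rel (V G) 0ℓ
  SameComponent T L = Star (AdjacentOutside T L)

  sameComponent? : ∀ T L → Decidable₂ (SameComponent T L)
  sameComponent? T L = star? (adjacentOutside? T L)

  -- A component B is presented by one of its vertices, so a branch occurs once
  -- for each vertex of B (and each choice of link).
  record Branch (T : Subgraph G) (L : List (V G)) : Set where
    field
      base         : V G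
      base∉L       : base ∉ L
      attachment   : V G
      attachment∈L : attachment ∈ L
      link         : V G
      link∈B       : SameComponent T L base link
      link-adj     : Adjacent T link attachment

  componentOf : Subgraph G → List (V G) → V G → List (V G)
  componentOf T L b = filter (sameComponent? T L b) vertices

  branchLength : ∀ {T L} → Branch T L → ℕ
  branchLength {T} {L} B =
    Extrema.max 0 (map (λ v → dist T v attachment) (componentOf T L base))
    where open Branch B

  all-branches-short? : ∀ T L ℓ → Dec (∀ (B : Branch T L) → branchLength B < ℓ)
  all-branches-short? T L ℓ =
    map′ (λ f B → let open Branch B in
            f base attachment link base∉L attachment∈L link∈B link-adj)
         (λ f b a w b∉ a∈ w∈ adj → f record
            { base = b ; base∉L = b∉ ; attachment = a ; attachment∈L = a∈
            ; link = w ; link∈B = w∈ ; link-adj = adj })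
         (all-vertices? λ b → all-vertices? λ a → all-vertices? λ w →
            (b ∉? L) →-dec ((a ∈? L) →-dec (sameComponent? T L b w →-dec
              (adjacent? T w a →-dec (_ <? ℓ)))))

next : ∀ {n} → Fin n → Fin n
next {suc n} i = suc (toℕ i) mod suc n

around : ∀ n m → List ((Fin n × Fin m) × (Fin n × Fin m))
around n m = map (λ (i , j) → (i , j) , (next i , j)) (cartesianProduct (allFin n) (allFin m))

along : ∀ n m → List ((Fin n × Fin m) × (Fin n × Fin m))
along n zero    = []
along n (suc m) =
  map (λ (i , j) → (i , inject₁ j) , (i , fsuc j)) (cartesianProduct (allFin n) (allFin m))

cylinder : ℕ → ℕ → Graph
cylinder n m = record
  { V                 = Fin n × Fin m
  ; _≟_               = Product.≡-dec Fin._≟_ Fin._≟_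
  ; vertices          = cartesianProduct (allFin n) (allFin m)
  ; vertices-complete = λ (i , j) → ∈-cartesianProduct⁺ (∈-allFin i) (∈-allFin j)
  ; edges             = around n m ++ along n m
  }

ring : ∀ {n m} → Fin m → List (Fin n × Fin m)
ring k = map (_, k) (allFin _)

boundary : ∀ n m → List (Fin n × Fin m)
boundary n zero    = []
boundary n (suc m) = ring fzero ++ ring (fromℕ m)

-- The new vertex (the sink) is nothing, joined to each vertex in the list.
wire : (G : Graph) → List (V G) → Graph
wire G vs = record
  { V                 = Maybe (V G)
  ; _≟_               = Maybe.≡-dec _≟_
  ; vertices          = nothing ∷ map just vertices
  ; vertices-complete = λ where
      nothing  → here refl
      (just v) → there (∈-map⁺ just (vertices-complete v))
  ; edges             = map (λ (u , v) → just u , just v) edges ++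
                        map (λ v → nothing , just v) vs
  }
  where open Graph G using (_≟_; vertices; vertices-complete; edges)

-- A simple graph when n ≥ 3 and m ≥ 2.
wiredCylinder : ℕ → ℕ → Graph
wiredCylinder n m = wire (cylinder n m) (boundary n m)

module _ (n m : ℕ) (T : Subgraph (wiredCylinder n m)) where

  IsTrunk : Pred (List (V (wiredCylinder n m))) 0ℓ
  IsTrunk L = IsSimplePath (wiredCylinder n m) T L ×
              (∀ (k : Fin m) → ∃ λ (i : Fin n) → just (i , k) ∈ L)

  IsSinkTrunk : Pred (List (V (wiredCylinder n m))) 0ℓ
  IsSinkTrunk L = IsTrunk L × nothing ∈ L

  open DecMembership (Graph._≟_ (wiredCylinder n m)) using (_∈?_)

  HasSinkTrunkWithBranchesShorterThan : ℕ → Set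
  HasSinkTrunkWithBranchesShorterThan ℓ =
    ∃ λ L → IsSinkTrunk L ×
            (∀ (B : Branch (wiredCylinder n m) T L) → branchLength (wiredCylinder n m) B < ℓ)

  hasSinkTrunkWithBranchesShorterThan? : ∀ ℓ → Dec (HasSinkTrunkWithBranchesShorterThan ℓ)
  hasSinkTrunkWithBranchesShorterThan? ℓ =
    map′ (λ (L , u , l , (r , s) , b) → L , (((u , l) , r) , s) , b)
         (λ (L , (((u , l) , r) , s) , b) → L , u , l , (r , s) , b)
         (any-unique-list? (wiredCylinder n m) λ L →
           linked? (adjacent? (wiredCylinder n m) T) L ×-dec
           ((Fin.all? (λ k → Fin.any? (λ i → just (i , k) ∈? L)) ×-dec (nothing ∈? L)) ×-dec
            all-branches-short? (wiredCylinder n m) T L ℓ))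

{-# OPTIONS --safe #-}

-- Call a level (the n vertical edges between two consecutive rings) narrow in T
-- if T uses at most one of its edges. Whatever T is outside the two rings
-- bounding a level, it can be completed to a spanning tree in which that level
-- is narrow: keep both rings and a single vertical edge, and prune cycles. As
-- only 3n edges change, this is at most 2^(3n)-to-one, so each further level
-- multiplies the number of trees without narrow level by at most K / (K + 1),
-- K = 2^(3n); some run of N levels avoids narrow ones with probability at most
-- m (K / (K + 1))^N.
--
-- Every tree has a sink-trunk crossing all levels but one: on a fixed column,
-- join the last vertex connected to ring 0 off the sink with the first one
-- connected to ring m - 1. A branch cannot cross a narrow level that the trunk
-- crosses, so if every run of N levels contains a narrow level then a branch
-- meets fewer than 4N rings, and has length at most 4nN.

module Submission where

open import Defs
open Graph using (V; Subgraph)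
open import Data.Empty using (⊥)
open import Data.Fin.Base using (Fin; toℕ; inject₁; fromℕ; fromℕ<) renaming (zero to fzero; suc to fsuc)
import Data.Fin.Induction as Fin
import Data.Fin.Properties as Fin
open import Data.Fin.Subset using (Subset; inside; outside; _⊆_)
  renaming (_∈_ to _∈ₛ_; _∉_ to _∉ₛ_; ⊥ to ∅; ⊤ to full; _-_ to _⊖_)
import Data.Fin.Subset.Properties as Subset
open import Data.List.Base
  using (List; []; _∷_; _++_; _∷ʳ_; map; filter; length; lookup; head; last; upTo; allFin;
         cartesianProduct)
import Data.List.Extrema.Nat as Extrema
import Data.List.Membership.DecPropositional as DecMembership
open import Data.List.Membership.Propositional using (_∈_; _∉_; lose)
open import Data.List.Membership.Propositional.Properties
open import Data.List.Properties
  using (length-filter; length-map; length-++; length-tabulate; length-upTo;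
         ++-assoc)
open import Data.List.Relation.Unary.All as All using (All; []; _∷_)
import Data.List.Relation.Unary.All.Properties as All
open import Data.List.Relation.Unary.AllPairs using ([]; _∷_)
open import Data.List.Relation.Unary.Any as Any using (here; there)
import Data.List.Relation.Unary.Any.Properties as Any
open import Data.List.Relation.Unary.Linked as Linked using (Linked; []; [-]; _∷_; _∷′_)
import Data.List.Relation.Unary.Linked.Properties as Linked
open import Data.List.Relation.Unary.Unique.Propositional using (Unique)
import Data.List.Relation.Unary.Unique.Propositional.Properties as Unique
open import Data.Maybe.Base using (just; nothing)
open import Data.Maybe.Properties using (just-injective)
open import Data.Maybe.Relation.Binary.Connected using (just; nothing-just; just-nothing)
  renaming (Connected to Meets)
open import Data.Nat.Base using (ℕ; zero; suc; s≤s; z≤n) renaming (_≥_ to _≥ℕ_)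
import Data.Nat.Base as ℕ
import Data.Nat.DivMod as ℕ
import Data.Nat.Properties as ℕ
open import Data.Product.Base using (∃; ∃₂; _×_; _,_; proj₁; proj₂)
open import Data.Product.Properties using (,-injectiveˡ; ,-injectiveʳ; ≡-dec)
open import Data.Sum.Base using (_⊎_; inj₁; inj₂; [_,_]′)
open import Data.Unit.Base using (⊤; tt)
open import Data.Vec.Base using ([]; _∷_; here; there; tabulate)
open import Data.Vec.Properties using (lookup∘tabulate; lookup⇒[]=; []=⇒lookup; ∷-injectiveʳ)
open import Function.Base using (_∘_; id)
open import Level using (0ℓ)
open import Relation.Binary.Construct.Closure.ReflexiveTransitive as Star using (Star; ε; _◅_; _◅◅_)
open import Relation.Binary.Core using (Rel)
open import Relation.Binary.Definitions using (tri<; tri≈; tri>)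
open import Relation.Binary.PropositionalEquality
open import Relation.Nullary using (¬_; Dec; yes; no; does; contradiction)
open import Relation.Nullary.Decidable using (¬?; _×-dec_; _⊎-dec_; _→-dec_; dec-true)
open import Relation.Unary using (Pred; Decidable)

-- Pruning can be confined to the two rings and their level: all other edges of the completed graph
-- come from the old tree, which is acyclic, so every cycle passes through the modified region and
-- can be cut there. The region contains vertical edges of one level only, so levels already known
-- not to be narrow remain so. Hence the factor K / (K + 1) is obtained level by level from counting
-- alone, with no independence between levels.
--
-- The 4 in 4N is 2 times 2: a run may be spoiled by the one level that the trunk misses, so two
-- runs are needed to stop a branch, and a branch may extend both upwards and downwards.
--
-- With N about l / (4n), the natural choice of theta is the 4n-th root of K / (K + 1), which need
-- not be rational. It is replaced by a slightly larger s / (s + 1); the constant C pays for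
-- rounding l to a multiple of 4n.

module Counting where
  open import Data.Nat.Base
  open import Data.Nat.Properties hiding (_≟_)

  -- Comparing sizes of lists.

  lookup-unique : {A : Set} {xs : List A} → Unique xs →
                  ∀ i j → lookup xs i ≡ lookup xs j → i ≡ j
  lookup-unique (_  ∷ _) fzero    fzero    _  = refl
  lookup-unique (x∉ ∷ _) fzero    (fsuc j) eq = contradiction eq (All.lookup x∉ (∈-lookup j))
  lookup-unique (x∉ ∷ _) (fsuc i) fzero    eq = contradiction (sym eq) (All.lookup x∉ (∈-lookup i))
  lookup-unique (_  ∷ u) (fsuc i) (fsuc j) eq = cong fsuc (lookup-unique u i j eq)

  -- An image is supplied only for members of `xs`, so the injection is given as a relation.
  -- Comparing positions instead of values turns it into an injection between index types, and
  -- repetitions in `ys` do no harm.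
  length-injective : {A B : Set} {xs : List A} {ys : List B} (R : A → B → Set) → Unique xs →
                     (∀ {x} → x ∈ xs → ∃ λ y → y ∈ ys × R x y) →
                     (∀ {x x′ y} → R x y → R x′ y → x ≡ x′) →
                     length xs ≤ length ys
  length-injective {xs = xs} {ys} R unique total injective =
    Fin.injective⇒≤ {f = position} λ {i} {j} → position-injective i j
    where
    image : ∀ i → ∃ λ y → y ∈ ys × R (lookup xs i) y
    image i = total (∈-lookup i)

    position : Fin (length xs) → Fin (length ys)
    position i = Any.index (proj₁ (proj₂ (image i)))

    position-injective : ∀ i j → position i ≡ position j → i ≡ j
    position-injective i j eq = lookup-unique unique i j
      (injective (proj₂ (proj₂ (image i))) (subst (R _) (sym yᵢ≡yⱼ) (proj₂ (proj₂ (image j)))))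
      where
      yᵢ≡yⱼ : proj₁ (image i) ≡ proj₁ (image j)
      yᵢ≡yⱼ = trans (Any.lookup-index (proj₁ (proj₂ (image i))))
             (trans (cong (lookup ys) eq) (sym (Any.lookup-index (proj₁ (proj₂ (image j))))))

  module _ {A : Set} where

    count : {P : Pred A 0ℓ} → Decidable P → List A → ℕ
    count P? xs = length (filter P? xs)

    count-⊎ : {P Q R : Pred A 0ℓ} (P? : Decidable P) (Q? : Decidable Q) (R? : Decidable R) →
              (∀ {x} → P x → Q x ⊎ R x) → ∀ xs → count P? xs ≤ count Q? xs + count R? xs
    count-⊎ P? Q? R? f [] = z≤n
    count-⊎ P? Q? R? f (x ∷ xs) with P? x | Q? x | R? x | count-⊎ P? Q? R? f xs
    ... | no  _ | no  _ | no  _ | ih = ih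
    ... | no  _ | no  _ | yes _ | ih = ≤-trans ih (+-monoʳ-≤ (count Q? xs) (n≤1+n _))
    ... | no  _ | yes _ | no  _ | ih = m≤n⇒m≤1+n ih
    ... | no  _ | yes _ | yes _ | ih = m≤n⇒m≤1+n (≤-trans ih (+-monoʳ-≤ (count Q? xs) (n≤1+n _)))
    ... | yes p | no ¬q | no ¬r | ih = contradiction (f p) [ ¬q , ¬r ]′
    ... | yes _ | no  _ | yes _ | ih = ≤-trans (s≤s ih) (≤-reflexive (sym (+-suc _ _)))
    ... | yes _ | yes _ | no  _ | ih = s≤s ih
    ... | yes _ | yes _ | yes _ | ih = s≤s (≤-trans ih (+-monoʳ-≤ (count Q? xs) (n≤1+n _)))

    count-none : {P : Pred A 0ℓ} (P? : Decidable P) → (∀ x → ¬ P x) → ∀ xs → count P? xs ≡ 0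
    count-none P? ¬p []       = refl
    count-none P? ¬p (x ∷ xs) with P? x
    ... | no  _ = count-none P? ¬p xs
    ... | yes p = contradiction p (¬p x)

    count-× : {P Q : Pred A 0ℓ} (P? : Decidable P) (Q? : Decidable Q) → ∀ xs →
              count (λ x → P? x ×-dec Q? x) xs + count (λ x → P? x ×-dec ¬? (Q? x)) xs ≡ count P? xs
    count-× P? Q? [] = refl
    count-× P? Q? (x ∷ xs) with P? x | Q? x | count-× P? Q? xs
    ... | no  _ | _     | ih = ih
    ... | yes _ | no  _ | ih = trans (+-suc _ _) (cong suc ih)
    ... | yes _ | yes _ | ih = cong suc ih

    length≤count+count : {P Q : Pred A 0ℓ} (P? : Decidable P) (Q? : Decidable Q) → ∀ xs →
                         (∀ {x} → x ∈ xs → P x ⊎ Q x) → length xs ≤ count P? xs + count Q? xs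
    length≤count+count P? Q? []       f = z≤n
    length≤count+count P? Q? (x ∷ xs) f with P? x | Q? x | length≤count+count P? Q? xs (f ∘ there)
    ... | no ¬p | no ¬q | _  = contradiction (f (here refl)) [ ¬p , ¬q ]′
    ... | no  _ | yes _ | ih = ≤-trans (s≤s ih) (≤-reflexive (sym (+-suc _ _)))
    ... | yes _ | no  _ | ih = s≤s ih
    ... | yes _ | yes _ | ih = s≤s (≤-trans ih (+-monoʳ-≤ (count P? xs) (n≤1+n _)))

  -- Geometric decay of the number of outcomes with a long run without events.

  module Runs {A : Set} (Event : ℕ → Pred A 0ℓ) (event? : ∀ a → Decidable (Event a)) where

    None : ℕ → ℕ → Pred A 0ℓ
    None a zero    x = ⊤
    None a (suc k) x = None a k x × ¬ Event (a + k) x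

    none? : ∀ a k → Decidable (None a k)
    none? a zero    x = yes tt
    none? a (suc k) x = none? a k x ×-dec ¬? (event? (a + k) x)

    NoneThen : ℕ → ℕ → Pred A 0ℓ
    NoneThen a k x = None a k x × Event (a + k) x

    noneThen? : ∀ a k → Decidable (NoneThen a k)
    noneThen? a k x = none? a k x ×-dec event? (a + k) x

    ¬none⇒event : ∀ a k {x} → ¬ None a k x → ∃ λ j → a ≤ j × j < a + k × Event j x
    ¬none⇒event a zero    ¬none = contradiction tt ¬none
    ¬none⇒event a (suc k) {x} ¬none with event? (a + k) x | none? a k x
    ... | yes e | _     = a + k , m≤m+n a k , ≤-reflexive (sym (+-suc a k)) , e
    ... | no ¬e | yes n = contradiction (n , ¬e) ¬none
    ... | no ¬e | no ¬no with ¬none⇒event a k ¬no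
    ...   | j , a≤j , j< , e = j , a≤j , ≤-trans j< (+-monoʳ-≤ a (n≤1+n k)) , e

    SomeNone : ℕ → ℕ → Pred A 0ℓ
    SomeNone k zero    x = ⊥
    SomeNone k (suc m) x = SomeNone k m x ⊎ None m k x

    someNone? : ∀ k m → Decidable (SomeNone k m)
    someNone? k zero    x = no λ ()
    someNone? k (suc m) x = someNone? k m x ⊎-dec none? m k x

    ¬someNone⇒¬none : ∀ k m {x} → ¬ SomeNone k m x → ∀ a → a < m → ¬ None a k x
    ¬someNone⇒¬none k (suc m) ¬some a a<m none with m≤n⇒m<n∨m≡n (s≤s⁻¹ a<m)
    ... | inj₁ a<m′ = ¬someNone⇒¬none k m (¬some ∘ inj₁) a a<m′ none
    ... | inj₂ refl = ¬some (inj₂ none)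

    module _ (xs : List A) (K : ℕ)
             (step : ∀ a k → count (none? a (suc k)) xs ≤
                             K * count (noneThen? a k) xs)
             where

      open ≤-Reasoning

      -- The outcomes counted by `w` split into `u`, where the next event fails too, and `v`, where
      -- it occurs. From `u ≤ K * v` follows `u * suc K ≤ K * (v + u) = K * w`, so each further
      -- index costs a factor K / (K + 1).
      none-decay : ∀ a k → count (none? a k) xs * suc K ^ k ≤ K ^ k * length xs
      none-decay a zero = begin
        count (none? a 0) xs * 1 ≡⟨ *-identityʳ _ ⟩
        count (none? a 0) xs     ≤⟨ length-filter (none? a 0) xs ⟩
        length xs                ≡⟨ *-identityˡ _ ⟨
        1 * length xs            ∎
      none-decay a (suc k) = begin
        u * (suc K * suc K ^ k)     ≡⟨ *-assoc u (suc K) (suc K ^ k) ⟨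
        u * suc K * suc K ^ k       ≤⟨ *-monoˡ-≤ (suc K ^ k) one-step ⟩
        K * w * suc K ^ k           ≡⟨ *-assoc K w (suc K ^ k) ⟩
        K * (w * suc K ^ k)         ≤⟨ *-monoʳ-≤ K (none-decay a k) ⟩
        K * (K ^ k * length xs)     ≡⟨ *-assoc K (K ^ k) (length xs) ⟨
        K * K ^ k * length xs       ∎
        where
        u v w : ℕ
        u = count (none? a (suc k)) xs
        v = count (noneThen? a k) xs
        w = count (none? a k) xs

        one-step : u * suc K ≤ K * w
        one-step = begin
          u * suc K     ≡⟨ *-suc u K ⟩
          u + u * K     ≤⟨ +-monoˡ-≤ (u * K) (step a k) ⟩
          K * v + u * K ≡⟨ cong (K * v +_) (*-comm u K) ⟩
          K * v + K * u ≡⟨ *-distribˡ-+ K v u ⟨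
          K * (v + u)   ≡⟨ cong (K *_) (count-× (none? a k) (event? (a + k)) xs) ⟩
          K * w         ∎

      someNone-decay : ∀ k m → count (someNone? k m) xs * suc K ^ k ≤ m * (K ^ k * length xs)
      someNone-decay k zero =
        ≤-reflexive (cong (_* suc K ^ k) (count-none (someNone? k 0) (λ _ ()) xs))
      someNone-decay k (suc m) = begin
        count (someNone? k (suc m)) xs * suc K ^ k
          ≤⟨ *-monoˡ-≤ (suc K ^ k) (count-⊎ (someNone? k (suc m)) (someNone? k m) (none? m k) id xs) ⟩
        (count (someNone? k m) xs + count (none? m k) xs) * suc K ^ k
          ≡⟨ *-distribʳ-+ (suc K ^ k) (count (someNone? k m) xs) _ ⟩
        count (someNone? k m) xs * suc K ^ k + count (none? m k) xs * suc K ^ k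
          ≤⟨ +-mono-≤ (someNone-decay k m) (none-decay m k) ⟩
        m * (K ^ k * length xs) + K ^ k * length xs
          ≡⟨ +-comm (m * (K ^ k * length xs)) _ ⟩
        suc m * (K ^ k * length xs) ∎

-- Cycles, redundant edges and pruning in a general graph.

module Graphs where
  open import Data.Nat.Base

  All-link : {A : Set} {P : Pred A 0ℓ} {R : Rel A 0ℓ} → (∀ {x y} → P x → R x y → P y) →
             ∀ {x xs} → P x → Linked R (x ∷ xs) → All P (x ∷ xs)
  All-link f px [-]      = px ∷ []
  All-link f px (r ∷ rs) = px ∷ All-link f (f px r) rs

  linked⇒star : {A : Set} {P : Pred A 0ℓ} {R S : Rel A 0ℓ} →
                (∀ {x y} → P x → P y → R x y → S x y) → ∀ {x z} xs →
                Linked R (x ∷ xs) → All P (x ∷ xs) → last (x ∷ xs) ≡ just z → Star S x z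
  linked⇒star f []       [-]      _             refl = ε
  linked⇒star f (y ∷ ys) (r ∷ rs) (px ∷ py ∷ ps) eq  = f px py r ◅ linked⇒star f ys rs (py ∷ ps) eq

  linked-∷ʳ⁻ : {A : Set} {R : Rel A 0ℓ} {w : A} (v : A) (vs : List A) → Linked R (v ∷ vs ∷ʳ w) →
               Linked R (v ∷ vs) × ∃ λ z → last (v ∷ vs) ≡ just z × R z w
  linked-∷ʳ⁻ v []       (r ∷ [-]) = [-] , v , refl , r
  linked-∷ʳ⁻ v (x ∷ vs) (r ∷ rs) with linked-∷ʳ⁻ x vs rs
  ... | l , z , eq , rz = r ∷ l , z , eq , rz

  linked-∷ʳ⁺ : {A : Set} {R : Rel A 0ℓ} {z w : A} (v : A) (vs : List A) → Linked R (v ∷ vs) →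
               last (v ∷ vs) ≡ just z → R z w → Linked R (v ∷ vs ∷ʳ w)
  linked-∷ʳ⁺ v []       [-]      refl r  = r ∷ [-]
  linked-∷ʳ⁺ v (x ∷ vs) (r ∷ rs) eq   r′ = r ∷ linked-∷ʳ⁺ x vs rs eq r′

  -- The list is cut at its first step of the second sort. Along a cycle this finds an edge that may
  -- be deleted.
  linked-⊎ : {A : Set} {R P Q : Rel A 0ℓ} → (∀ {x y} → R x y → P x y ⊎ Q x y) →
             ∀ {xs} → Linked R xs → Linked P xs ⊎
             ∃₂ λ as x → ∃₂ λ y bs → xs ≡ as ++ x ∷ y ∷ bs × Q x y ×
                           Linked R (as ∷ʳ x) × Linked R (y ∷ bs)
  linked-⊎ f []  = inj₁ []
  linked-⊎ f [-] = inj₁ [-]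
  linked-⊎ {R = R} f (r ∷ rs) with f r
  ... | inj₂ q = inj₂ ([] , _ , _ , _ , refl , q , [-] , rs)
  ... | inj₁ p with linked-⊎ f rs
  ...   | inj₁ l = inj₁ (p ∷ l)
  ...   | inj₂ ([]     , x , y , bs , refl , q , l , l′) = inj₂ (_ ∷ [] , x , y , bs , refl , q , r ∷ l , l′)
  ...   | inj₂ (a ∷ as , x , y , bs , refl , q , l , l′) = inj₂ (_ ∷ a ∷ as , x , y , bs , refl , q , r ∷ l , l′)

  head-∈ : {A : Set} {z : A} (xs : List A) → head xs ≡ just z → z ∈ xs
  head-∈ (x ∷ xs) refl = here refl

  last-∈ : {A : Set} {z : A} (xs : List A) → last xs ≡ just z → z ∈ xs
  last-∈ (x ∷ [])     refl = here refl
  last-∈ (x ∷ y ∷ xs) eq   = there (last-∈ (y ∷ xs) eq)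

  last-++ : {A : Set} {z : A} (as : List A) (y : A) (bs : List A) →
            last (as ++ y ∷ bs) ≡ just z → last (y ∷ bs) ≡ just z
  last-++ []           y bs eq = eq
  last-++ (a ∷ [])     y bs eq = eq
  last-++ (a ∷ b ∷ as) y bs eq = last-++ (b ∷ as) y bs eq

  unique-split : {A : Set} {x y : A} {bs : List A} (as : List A) → Unique (as ++ x ∷ y ∷ bs) →
                 All (_≢ y) (as ∷ʳ x) × All (_≢ x) (y ∷ bs)
  unique-split []       ((x≢y ∷ x∉bs) ∷ _) = x≢y ∷ [] , All.map (_∘ sym) (x≢y ∷ x∉bs)
  unique-split (a ∷ as) (a∉ ∷ un) with unique-split as un
  ... | ∉y , ∉x = All.lookup a∉ (Any.++⁺ʳ as (there (here refl))) ∷ ∉y , ∉x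

  last-∷ʳ : {A : Set} (as : List A) (x : A) → last (as ∷ʳ x) ≡ just x
  last-∷ʳ []           x = refl
  last-∷ʳ (a ∷ [])     x = refl
  last-∷ʳ (a ∷ b ∷ as) x = last-∷ʳ (b ∷ as) x

  x∉p⊖x : ∀ {n} (p : Subset n) x → x ∉ₛ p ⊖ x
  x∉p⊖x (_ ∷ p) fzero    ()
  x∉p⊖x (_ ∷ p) (fsuc x) (there x∈) = x∉p⊖x p x x∈

  module _ (G : Graph) where
    open Graph G using (edges)

    Edge : Set
    Edge = Fin (length edges)

    Ends : Edge → Rel (V G) 0ℓ
    Ends e u v = lookup edges e ≡ (u , v) ⊎ lookup edges e ≡ (v , u)

    ends-sym : ∀ {e u v} → Ends e u v → Ends e v u
    ends-sym (inj₁ eq) = inj₂ eq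
    ends-sym (inj₂ eq) = inj₁ eq

    ends-unique : ∀ {e u v x y} → Ends e u v → Ends e x y → (u ≡ x × v ≡ y) ⊎ (u ≡ y × v ≡ x)
    ends-unique (inj₁ p) (inj₁ q) with trans (sym p) q
    ... | refl = inj₁ (refl , refl)
    ends-unique (inj₁ p) (inj₂ q) with trans (sym p) q
    ... | refl = inj₂ (refl , refl)
    ends-unique (inj₂ p) (inj₁ q) with trans (sym p) q
    ... | refl = inj₂ (refl , refl)
    ends-unique (inj₂ p) (inj₂ q) with trans (sym p) q
    ... | refl = inj₁ (refl , refl)

    adjacent-sym : ∀ {T u v} → Adjacent G T u v → Adjacent G T v u
    adjacent-sym {T} (e , e∈T , ends) = e , e∈T , ends-sym ends

    adjacent-mono : ∀ {T U : Subgraph G} → T ⊆ U → ∀ {u v} → Adjacent G T u v → Adjacent G U u v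
    adjacent-mono T⊆U (e , e∈T , ends) = e , T⊆U e∈T , ends

    connected-mono : ∀ {T U : Subgraph G} → T ⊆ U → Connected G T → Connected G U
    connected-mono {T} {U} T⊆U conn u v = Star.map (adjacent-mono {T} {U} T⊆U) (conn u v)

    connected-by : ∀ {T U : Subgraph G} → (∀ {e u v} → e ∈ₛ T → Ends e u v → Star (Adjacent G U) u v) →
                   Connected G T → Connected G U
    connected-by f conn u v = Star.concat (Star.map (λ (e , e∈T , ends) → f e∈T ends) (conn u v))

    prune : List Edge → Subgraph G → Subgraph G
    prune []       T = T
    prune (e ∷ es) T with connected? G (T ⊖ e)
    ... | yes _ = prune es (T ⊖ e)
    ... | no  _ = prune es T

    prune-⊆ : ∀ es T → prune es T ⊆ T
    prune-⊆ []       T = id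
    prune-⊆ (e ∷ es) T with connected? G (T ⊖ e)
    ... | yes _ = Subset.p─q⊆p T _ ∘ prune-⊆ es (T ⊖ e)
    ... | no  _ = prune-⊆ es T

    prune-connected : ∀ es T → Connected G T → Connected G (prune es T)
    prune-connected []       T conn = conn
    prune-connected (e ∷ es) T conn with connected? G (T ⊖ e)
    ... | yes c = prune-connected es (T ⊖ e) c
    ... | no  _ = prune-connected es T conn

    prune-keeps : ∀ es T {e} → e ∈ₛ T → e ∉ es → e ∈ₛ prune es T
    prune-keeps []       T e∈T e∉ = e∈T
    prune-keeps (f ∷ es) T e∈T e∉ with connected? G (T ⊖ f)
    ... | yes _ = prune-keeps es (T ⊖ f) (Subset.x∈p∧x≢y⇒x∈p-y e∈T (e∉ ∘ here)) (e∉ ∘ there)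
    ... | no  _ = prune-keeps es T e∈T (e∉ ∘ there)

    ⊖-mono : ∀ {T U : Subgraph G} e → T ⊆ U → T ⊖ e ⊆ U ⊖ e
    ⊖-mono {T} {U} e T⊆U {x} x∈ with x Fin.≟ e
    ... | yes refl = contradiction x∈ (x∉p⊖x T x)
    ... | no  x≢e  = Subset.x∈p∧x≢y⇒x∈p-y (T⊆U (Subset.p─q⊆p T _ x∈)) x≢e

    -- An edge is kept only if its deletion would have disconnected the graph of that moment. Later
    -- deletions only shrink the graph, so the edge is still a bridge at the end, and a single pass
    -- suffices.
    prune-minimal : ∀ es T {e} → e ∈ es → e ∈ₛ prune es T → ¬ Connected G (prune es T ⊖ e)
    prune-minimal (f ∷ es) T (here refl) e∈ conn with connected? G (T ⊖ f)
    ... | yes _ = x∉p⊖x T f (prune-⊆ es (T ⊖ f) e∈)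
    ... | no ¬c = ¬c (connected-mono (⊖-mono f (prune-⊆ es T)) conn)
    prune-minimal (f ∷ es) T (there e∈es) e∈ conn with connected? G (T ⊖ f)
    ... | yes _ = prune-minimal es (T ⊖ f) e∈es e∈ conn
    ... | no  _ = prune-minimal es T e∈es e∈ conn

    avoid-connected : ∀ (T : Subgraph G) {e x y} → Connected G T → Ends e x y →
                      Star (Adjacent G (T ⊖ e)) y x → Connected G (T ⊖ e)
    avoid-connected T {e} {x} {y} conn exy star = connected-by {T} {T ⊖ e} detour conn
      where
      detour : ∀ {e′ u v} → e′ ∈ₛ T → Ends e′ u v → Star (Adjacent G (T ⊖ e)) u v
      detour {e′} e′∈T ends with e′ Fin.≟ e
      ... | no e′≢e = (e′ , Subset.x∈p∧x≢y⇒x∈p-y e′∈T e′≢e , ends) ◅ ε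
      ... | yes refl with ends-unique exy ends
      ...   | inj₁ (refl , refl) = Star.reverse (adjacent-sym {T ⊖ e}) star
      ...   | inj₂ (refl , refl) = star

    avoid-step : ∀ {T : Subgraph G} {e u v} → Adjacent G T u v → ¬ Ends e u v →
                 Adjacent G (T ⊖ e) u v
    avoid-step (e′ , e′∈T , ends) ¬ends =
      e′ , Subset.x∈p∧x≢y⇒x∈p-y e′∈T (λ { refl → ¬ends ends }) , ends

    avoid-linked : ∀ {T : Subgraph G} {e x y u w} us → Ends e x y → Linked (Adjacent G T) (u ∷ us) →
                   All (_≢ x) (u ∷ us) → last (u ∷ us) ≡ just w → Star (Adjacent G (T ⊖ e)) u w
    avoid-linked {T} us exy = linked⇒star (λ u≢x v≢x adj → avoid-step {T} adj
      λ ends → [ (λ (x≡u , _) → u≢x (sym x≡u)) , (λ (x≡v , _) → v≢x (sym x≡v)) ]′ (ends-unique exy ends)) us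

    -- A cycle without an edge satisfying `P` would lie in the acyclic `F`. Once such an edge `e` is
    -- found, the rest of the cycle joins its ends. To see that no step of the rest uses `e`, it is
    -- enough that the step misses an end of `e`: on a repetition-free cycle the part after `y`
    -- misses `x` and the part before `x` misses `y`.
    cycle-edge-redundant :
      ∀ {T F : Subgraph G} {P : Pred Edge 0ℓ} → (∀ {e} → e ∈ₛ T → P e ⊎ e ∈ₛ F) → Acyclic G F →
      ∀ {c} → Unique c → Closed G T c →
      ∃ λ e → e ∈ₛ T × P e × ∃₂ λ x y → Ends e x y × Star (Adjacent G (T ⊖ e)) y x
    cycle-edge-redundant {T} {F} {P} split acyclic {v ∷ vs} unique (2≤ , linked) = go vs unique 2≤ linked
      where
      classify : ∀ {x y} → Adjacent G T x y →
                 Adjacent G F x y ⊎ ∃ λ e → e ∈ₛ T × P e × Ends e x y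
      classify (e , e∈T , ends) with split e∈T
      ... | inj₁ p   = inj₂ (e , e∈T , p , ends)
      ... | inj₂ e∈F = inj₁ (e , e∈F , ends)

      go : ∀ vs → Unique (v ∷ vs) → 2 ≤ length vs → Linked (Adjacent G T) (v ∷ vs ∷ʳ v) →
           ∃ λ e → e ∈ₛ T × P e × ∃₂ λ x y → Ends e x y × Star (Adjacent G (T ⊖ e)) y x
      go vs un 2≤ linked with linked-∷ʳ⁻ v vs linked
      go vs un 2≤ linked | path , z , last≡z , closing with linked-⊎ classify path
      go vs un 2≤ linked | path , z , last≡z , closing | inj₁ inF with classify closing
      ... | inj₁ adj = contradiction
              (v ∷ vs , un , 2≤ , linked-∷ʳ⁺ v vs inF last≡z adj) acyclic
      -- The open path lies in `F`, so the deletable edge is the closing one, and the open path is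
      -- its detour. After the first step this path misses `v`.
      go (x ∷ x′ ∷ xs) (v∉ ∷ x∉ ∷ _) 2≤ linked | v~x ∷ path , z , last≡z , _ | inj₁ _
        | inj₂ (e , e∈T , p , ends) =
        e , e∈T , p , z , v , ends ,
        avoid-step {T} v~x ¬ends ◅
        avoid-linked {T} (x′ ∷ xs) (ends-sym {e} ends) path (All.map (_∘ sym) v∉) last≡z
        where
        ¬ends : ¬ Ends e v x
        ¬ends ends′ with ends-unique {e} ends ends′
        ... | inj₁ (refl , _) = All.lookup v∉ (last-∈ (x ∷ x′ ∷ xs) last≡z) refl
        ... | inj₂ (refl , _) = All.lookup x∉ (last-∈ (x′ ∷ xs) last≡z) refl
      go _ _ (s≤s ()) _ | _ ∷ [-] , _ | inj₁ _ | inj₂ _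
      go vs un 2≤ linked | path , z , last≡z , closing
        | inj₂ ([] , x , y , bs , refl , (e , e∈T , p , ends) , l , l′) =
        e , e∈T , p , x , y , ends ,
        avoid-linked {T} bs ends l′ (proj₂ (unique-split [] un)) last≡z ◅◅
        avoid-step {T} closing ¬ends ◅ ε
        where
        ¬ends : ¬ Ends e z x
        ¬ends ends′ with ends-unique {e} ends ends′
        ... | inj₁ (refl , _) = All.lookup (proj₂ (unique-split [] un)) (last-∈ (y ∷ bs) last≡z) refl
        -- The closing step could repeat `e` only on a cycle of two vertices, which goes back and
        -- forth along one edge; this is where the length bound in `Closed` enters.
        ... | inj₂ (_ , refl) = ¬last bs 2≤ un last≡z
          where
          ¬last : ∀ bs → 2 ≤ length (y ∷ bs) → Unique (x ∷ y ∷ bs) → ¬ last (y ∷ bs) ≡ just y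
          ¬last []       (s≤s ()) _ _
          ¬last (b ∷ bs) _ (_ ∷ y∉ ∷ _) eq = All.lookup y∉ (last-∈ (b ∷ bs) eq) refl
      go vs un@(v∉ ∷ _) 2≤ linked | path , z , last≡z , closing
        | inj₂ (_ ∷ as , x , y , bs , refl , (e , e∈T , p , ends) , l , l′) =
        e , e∈T , p , x , y , ends ,
        avoid-linked {T} bs ends l′ ∉x last≡z′ ◅◅
        avoid-step {T} closing ¬ends ◅
        avoid-linked {T} (as ∷ʳ x) (ends-sym {e} ends) l ∉y (last-∷ʳ (v ∷ as) x)
        where
        ∉y : All (_≢ y) (v ∷ as ∷ʳ x)
        ∉y = proj₁ (unique-split (v ∷ as) un)

        ∉x : All (_≢ x) (y ∷ bs)
        ∉x = proj₂ (unique-split (v ∷ as) un)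

        last≡z′ : last (y ∷ bs) ≡ just z
        last≡z′ = last-++ (v ∷ as ∷ʳ x) y bs
          (trans (cong last (++-assoc (v ∷ as) (x ∷ []) (y ∷ bs))) last≡z)

        ¬ends : ¬ Ends e z v
        ¬ends ends′ with ends-unique {e} ends ends′
        ... | inj₁ (refl , _) = All.lookup ∉x (last-∈ (y ∷ bs) last≡z′) refl
        ... | inj₂ (refl , _) = All.lookup v∉ (Any.++⁺ʳ as (here refl)) refl

    ∅-acyclic : Acyclic G ∅
    ∅-acyclic (v ∷ vs@(_ ∷ _) , _ , _ , (e , e∈∅ , _) ∷ _) = Subset.∉⊥ e∈∅
    ∅-acyclic (v ∷ [] , _ , () , _)

    -- A cycle surviving the pruning would contain a redundant edge from `es`, against minimality.
    -- With `F` an old tree, only the edges in `es` are at risk, which keeps the change local; with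
    -- `F` empty, the lemma gives the existence of a spanning tree.
    extend-to-tree : ∀ (U F : Subgraph G) (es : List Edge) → Connected G U → Acyclic G F →
                     (∀ {e} → e ∈ₛ U → e ∈ es ⊎ e ∈ₛ F) →
                     ∃ λ T → IsSpanningTree G T × T ⊆ U × (∀ {e} → e ∈ₛ U → e ∉ es → e ∈ₛ T)
    extend-to-tree U F es conn acyclic split =
      prune es U , (connected , acyclic′) , prune-⊆ es U , prune-keeps es U
      where
      connected : Connected G (prune es U)
      connected = prune-connected es U conn

      acyclic′ : Acyclic G (prune es U)
      acyclic′ (c , un , closed)
        with cycle-edge-redundant {prune es U} {F} {_∈ es} (split ∘ prune-⊆ es U) acyclic un closed
      ... | e , e∈T , e∈es , x , y , ends , star =
        prune-minimal es U e∈es e∈T (avoid-connected (prune es U) connected ends star)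

-- The list of spanning trees, and how a local modification affects counts.

module SpanningTrees where
  open import Data.Nat.Base
  open import Data.Nat.Properties hiding (_≟_)
  open Counting
  open Graphs

  ⟪_⟫ : ∀ {k} {P : Pred (Fin k) 0ℓ} → Decidable P → Subset k
  ⟪ P? ⟫ = tabulate (does ∘ P?)

  module _ {k : ℕ} {P : Pred (Fin k) 0ℓ} (P? : Decidable P) where

    ∈-⟪⟫⁺ : ∀ {i} → P i → i ∈ₛ ⟪ P? ⟫
    ∈-⟪⟫⁺ {i} p = lookup⇒[]= i _ (trans (lookup∘tabulate _ i) (dec-true (P? i) p))

    ∈-⟪⟫⁻ : ∀ {i} → i ∈ₛ ⟪ P? ⟫ → P i
    ∈-⟪⟫⁻ {i} i∈ with P? i | trans (sym (lookup∘tabulate (does ∘ P?) i)) ([]=⇒lookup i∈)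
    ... | yes p | _ = p

  length-cartesianProduct : {A B : Set} (xs : List A) (ys : List B) →
                            length (cartesianProduct xs ys) ≡ length xs * length ys
  length-cartesianProduct []       ys = refl
  length-cartesianProduct (x ∷ xs) ys = trans (length-++ (map (x ,_) ys))
    (cong₂ _+_ (length-map _ ys) (length-cartesianProduct xs ys))

  ∈-subsets : ∀ {k} (T : Subset k) → T ∈ subsets k
  ∈-subsets []            = here refl
  ∈-subsets (outside ∷ T) = ∈-++⁺ˡ (∈-map⁺ (outside ∷_) (∈-subsets T))
  ∈-subsets (inside  ∷ T) = ∈-++⁺ʳ (map (outside ∷_) (subsets _)) (∈-map⁺ (inside ∷_) (∈-subsets T))

  subsets-unique : ∀ k → Unique (subsets k)
  subsets-unique zero    = [] ∷ []
  subsets-unique (suc k) =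
    Unique.++⁺ (Unique.map⁺ ∷-injectiveʳ (subsets-unique k)) (Unique.map⁺ ∷-injectiveʳ (subsets-unique k))
               λ (T∈ , T∈′) → disjoint (∈-map⁻ (outside ∷_) T∈) (∈-map⁻ (inside ∷_) T∈′)
    where
    disjoint : ∀ {T} → ∃ (λ U → U ∈ subsets k × T ≡ outside ∷ U) →
               ¬ ∃ (λ U → U ∈ subsets k × T ≡ inside ∷ U)
    disjoint (_ , _ , refl) (_ , _ , ())

  length-subsets : ∀ k → length (subsets k) ≡ 2 ^ k
  length-subsets zero    = refl
  length-subsets (suc k) = trans (length-++ (map (outside ∷_) (subsets k)))
    (cong₂ _+_ (trans (length-map _ (subsets k)) (length-subsets k))
               (trans (trans (length-map _ (subsets k)) (length-subsets k)) (sym (+-identityʳ _))))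

  module _ (G : Graph) where
    open Graph G using (_≟_; edges)
    private _≟ₑ_ = ≡-dec _≟_ _≟_
    open DecMembership _≟ₑ_ using (_∈?_)

    trees-unique : Unique (spanningTrees G)
    trees-unique = Unique.filter⁺ (isSpanningTree? G) (subsets-unique (length edges))

    -- The exceptional edges are listed by their ends and not by index, so that a window can be
    -- written down geometrically and its length read off.
    AgreeOff : List (V G × V G) → Rel (Subgraph G) 0ℓ
    AgreeOff ws T T′ = ∀ e → lookup edges e ∉ ws → (e ∈ₛ T → e ∈ₛ T′) × (e ∈ₛ T′ → e ∈ₛ T)

    -- T is determined by T′, with which it agrees off ws, and by its trace on ws.
    modification-count :
      Unique edges → {P Q : Pred (Subgraph G) 0ℓ} (P? : Decidable P) (Q? : Decidable Q) →
      (ws : List (V G × V G)) →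
      (∀ T → IsSpanningTree G T → P T → ∃ λ T′ → IsSpanningTree G T′ × Q T′ × AgreeOff ws T T′) →
      count P? (spanningTrees G) ≤ 2 ^ length ws * count Q? (spanningTrees G)
    modification-count unique {P} {Q} P? Q? ws modify = begin
      count P? (spanningTrees G)
        ≤⟨ length-injective R (Unique.filter⁺ P? trees-unique) total injective ⟩
      length (cartesianProduct (subsets (length ws)) (filter Q? (spanningTrees G)))
        ≡⟨ length-cartesianProduct (subsets (length ws)) _ ⟩
      length (subsets (length ws)) * count Q? (spanningTrees G)
        ≡⟨ cong (_* count Q? (spanningTrees G)) (length-subsets (length ws)) ⟩
      2 ^ length ws * count Q? (spanningTrees G) ∎
      where
      open ≤-Reasoning

      Occurs : Subgraph G → Pred (Fin (length ws)) 0ℓ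
      Occurs T i = ∃ λ e → e ∈ₛ T × lookup edges e ≡ lookup ws i

      occurs? : ∀ T → Decidable (Occurs T)
      occurs? T i = Fin.any? λ e → (e Subset.∈? T) ×-dec (lookup edges e ≟ₑ lookup ws i)

      R : Subgraph G → Subset (length ws) × Subgraph G → Set
      R T (c , T′) = AgreeOff ws T T′ × c ≡ ⟪ occurs? T ⟫

      total : ∀ {T} → T ∈ filter P? (spanningTrees G) →
              ∃ λ y → y ∈ cartesianProduct (subsets (length ws)) (filter Q? (spanningTrees G)) × R T y
      total {T} T∈ with ∈-filter⁻ P? {xs = spanningTrees G} T∈
      ... | T∈trees , pT with ∈-filter⁻ (isSpanningTree? G) {xs = subsets (length edges)} T∈trees
      ...   | _ , tree with modify T tree pT
      ...     | T′ , tree′ , q , agree =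
        (⟪ occurs? T ⟫ , T′) ,
        ∈-cartesianProduct⁺ (∈-subsets _)
          (∈-filter⁺ Q? (∈-filter⁺ (isSpanningTree? G) (∈-subsets T′) tree′) q) ,
        agree , refl

      R⊆ : ∀ {T U y} → R T y → R U y → T ⊆ U
      R⊆ {T} {U} (agreeT , cT) (agreeU , cU) {e} e∈T with lookup edges e ∈? ws
      ... | no  e∉ws = proj₂ (agreeU e e∉ws) (proj₁ (agreeT e e∉ws) e∈T)
      ... | yes e∈ws with ∈-⟪⟫⁻ (occurs? U) (subst (Any.index e∈ws ∈ₛ_) (trans (sym cT) cU)
                            (∈-⟪⟫⁺ (occurs? T) (e , e∈T , Any.lookup-index e∈ws)))
      ...   | e′ , e′∈U , eq = subst (_∈ₛ U)
                (lookup-unique unique e′ e (trans eq (sym (Any.lookup-index e∈ws)))) e′∈U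

      injective : ∀ {T U y} → R T y → R U y → T ≡ U
      injective RT RU = Subset.⊆-antisym (R⊆ RT RU) (R⊆ RU RT)

    spanning-tree-exists : Connected G full → ∃ λ T → T ∈ spanningTrees G
    spanning-tree-exists conn with extend-to-tree G full ∅ (allFin _) conn (∅-acyclic G) (λ {e} _ → inj₁ (∈-allFin e))
    ... | T , tree , _ = T , ∈-filter⁺ (isSpanningTree? G) (∈-subsets T) tree

-- The wired cylinder: narrowing a level, and the trunk.

module Cylinders where
  open import Data.Nat.Base
  open import Data.Nat.Properties hiding (_≟_)
  open import Data.Nat.DivMod using (m<n⇒m%n≡m)
  open Counting
  open Graphs
  open SpanningTrees

  n≢2+n : ∀ {k} → k ≢ suc (suc k)
  n≢2+n {suc k} eq = n≢2+n (suc-injective eq)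

  module Cylinder (p q : ℕ) where

    n m : ℕ
    n = suc p
    m = suc (suc q)

    G : Graph
    G = wiredCylinder n m

    open Graph G using (edges)

    -- The value at the sink is a convention; the estimates concern walks that avoid the sink.
    height : V G → ℕ
    height nothing        = 0
    height (just (i , j)) = toℕ j

    horₑ : Fin n → Fin m → V G × V G
    horₑ i j = just (i , j) , just (next i , j)

    verₑ : Fin n → Fin (suc q) → V G × V G
    verₑ i j = just (i , inject₁ j) , just (i , fsuc j)

    spokeₑ : Fin n → Fin m → V G × V G
    spokeₑ i j = nothing , just (i , j)

    data Kind : V G × V G → Set where
      hor   : ∀ i j → Kind (horₑ i j)
      ver   : ∀ i j → Kind (verₑ i j)
      spoke : ∀ i {j} → j ≡ fzero ⊎ j ≡ fromℕ (suc q) → Kind (spokeₑ i j)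

    private
      lift : (Fin n × Fin m) × (Fin n × Fin m) → V G × V G
      lift (u , v) = just u , just v

    edge-kind : ∀ {uv} → uv ∈ edges → Kind uv
    edge-kind uv∈ with ∈-++⁻ (map lift (around n m ++ along n m)) uv∈
    edge-kind uv∈ | inj₁ uv∈′ with ∈-map⁻ lift uv∈′
    edge-kind uv∈ | inj₁ uv∈′ | _ , e∈ , refl with ∈-++⁻ (around n m) e∈
    edge-kind uv∈ | inj₁ uv∈′ | _ , e∈ , refl | inj₁ e∈′ with ∈-map⁻ _ {xs = cartesianProduct (allFin n) (allFin m)} e∈′
    ... | (i , j) , _ , refl = hor i j
    edge-kind uv∈ | inj₁ uv∈′ | _ , e∈ , refl | inj₂ e∈′ with ∈-map⁻ _ {xs = cartesianProduct (allFin n) (allFin (suc q))} e∈′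
    ... | (i , j) , _ , refl = ver i j
    edge-kind uv∈ | inj₂ uv∈′ with ∈-map⁻ _ {xs = boundary n m} uv∈′
    edge-kind uv∈ | inj₂ uv∈′ | _ , v∈ , refl with ∈-++⁻ (ring fzero) v∈
    edge-kind uv∈ | inj₂ uv∈′ | _ , v∈ , refl | inj₁ v∈′ with ∈-map⁻ _ {xs = allFin n} v∈′
    ... | i , _ , refl = spoke i (inj₁ refl)
    edge-kind uv∈ | inj₂ uv∈′ | _ , v∈ , refl | inj₂ v∈′ with ∈-map⁻ _ {xs = allFin n} v∈′
    ... | i , _ , refl = spoke i (inj₂ refl)

    ends-kind : ∀ {e u v} → Ends G e u v → Kind (u , v) ⊎ Kind (v , u)
    ends-kind {e} (inj₁ eq) = inj₁ (edge-kind (subst (_∈ edges) eq (∈-lookup e)))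
    ends-kind {e} (inj₂ eq) = inj₂ (edge-kind (subst (_∈ edges) eq (∈-lookup e)))

    hor∈ : ∀ i j → horₑ i j ∈ edges
    hor∈ i j = ∈-++⁺ˡ (∈-map⁺ lift (∈-++⁺ˡ (∈-map⁺ (λ (i , j) → (i , j) , (next i , j))
      (∈-cartesianProduct⁺ (∈-allFin i) (∈-allFin j)))))

    ver∈ : ∀ i j → verₑ i j ∈ edges
    ver∈ i j = ∈-++⁺ˡ (∈-map⁺ lift (∈-++⁺ʳ (around n m)
      (∈-map⁺ (λ (i , j) → (i , inject₁ j) , (i , fsuc j))
        (∈-cartesianProduct⁺ (∈-allFin i) (∈-allFin j)))))

    spoke∈ : ∀ i → spokeₑ i fzero ∈ edges
    spoke∈ i = ∈-++⁺ʳ (map lift (around n m ++ along n m))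
      (∈-map⁺ (λ v → nothing , just v) (∈-++⁺ˡ (∈-map⁺ (_, fzero) (∈-allFin i))))

    inject₁≢suc : ∀ (j : Fin (suc q)) → inject₁ j ≢ fsuc j
    inject₁≢suc j eq = 1+n≢n (trans (sym (cong toℕ eq)) (Fin.toℕ-inject₁ j))

    hor≢ver : ∀ {i i′ j j′} → horₑ i j ≢ verₑ i′ j′
    hor≢ver {j′ = j′} eq = inject₁≢suc j′ (trans
      (sym (cong proj₂ (just-injective (,-injectiveˡ eq)))) (cong proj₂ (just-injective (,-injectiveʳ eq))))

    -- Makes an edge recoverable from its ordered pair of ends, which is how a tree is reconstructed
    -- from its trace on a window.
    edges-unique : Unique edges
    edges-unique = Unique.++⁺
      (Unique.map⁺ (λ { {_ , _} {_ , _} refl → refl })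
        (Unique.++⁺
          (Unique.map⁺ (λ { {_ , _} {_ , _} eq → ,-injectiveˡ eq })
            (Unique.cartesianProduct⁺ (Unique.allFin⁺ n) (Unique.allFin⁺ m)))
          (Unique.map⁺ (λ { {_ , _} {_ , _} refl → refl })
            (Unique.cartesianProduct⁺ (Unique.allFin⁺ n) (Unique.allFin⁺ (suc q))))
          λ (e∈ , e∈′) → around-along (∈-map⁻ _ {xs = cartesianProduct (allFin n) (allFin m)} e∈)
                                       (∈-map⁻ _ {xs = cartesianProduct (allFin n) (allFin (suc q))} e∈′)))
      (Unique.map⁺ (λ { refl → refl })
        (Unique.++⁺ (Unique.map⁺ ,-injectiveˡ (Unique.allFin⁺ n)) (Unique.map⁺ ,-injectiveˡ (Unique.allFin⁺ n))
          λ (v∈ , v∈′) → rings (∈-map⁻ _ {xs = allFin n} v∈) (∈-map⁻ _ {xs = allFin n} v∈′)))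
      λ (e∈ , e∈′) → grid-spoke (∈-map⁻ lift e∈) (∈-map⁻ (λ v → nothing , just v) {xs = boundary n m} e∈′)
      where
      around-along : ∀ {uv} →
                     (∃ λ (ij : Fin n × Fin m) → ij ∈ cartesianProduct (allFin n) (allFin m) ×
                       uv ≡ (ij , (next (proj₁ ij) , proj₂ ij))) →
                     ¬ ∃ λ (ij : Fin n × Fin (suc q)) →
                       ij ∈ cartesianProduct (allFin n) (allFin (suc q)) ×
                       uv ≡ ((proj₁ ij , inject₁ (proj₂ ij)) , (proj₁ ij , fsuc (proj₂ ij)))
      around-along (_ , _ , refl) ((_ , j) , _ , eq) = hor≢ver {j′ = j} (cong lift eq)

      rings : ∀ {v : Fin n × Fin m} → (∃ λ i → i ∈ allFin n × v ≡ (i , fzero)) →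
              ¬ ∃ λ i → i ∈ allFin n × v ≡ (i , fromℕ (suc q))
      rings (_ , _ , refl) (_ , _ , ())

      grid-spoke : ∀ {uv} → (∃ λ e → e ∈ (around n m ++ along n m) × uv ≡ lift e) →
                   ¬ ∃ λ v → v ∈ boundary n m × uv ≡ (nothing , just v)
      grid-spoke (_ , _ , refl) (_ , _ , ())

    kind-up : ∀ {uv i x i′ y} → Kind uv → uv ≡ (just (i , x) , just (i′ , y)) → toℕ y ≡ suc (toℕ x) →
              i ≡ i′ × ∃ λ j → uv ≡ verₑ i j × x ≡ inject₁ j
    kind-up (hor i j) refl y≡ = contradiction (sym y≡) 1+n≢n
    kind-up (ver i j) refl y≡ = refl , j , refl , refl

    kind-not-down : ∀ {uv i x i′ y} → Kind uv → uv ≡ (just (i , x) , just (i′ , y)) → toℕ x ≢ suc (toℕ y)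
    kind-not-down (hor i j) refl x≡ = 1+n≢n (sym x≡)
    kind-not-down (ver i j) refl x≡ = n≢2+n (trans (sym (Fin.toℕ-inject₁ j)) x≡)

    Crossing : Subgraph G → ℕ → Fin n → Set
    Crossing T a i = ∃₂ λ x y → toℕ x ≡ a × toℕ y ≡ suc a × Adjacent G T (just (i , x)) (just (i , y))

    Narrow : ℕ → Subgraph G → Set
    Narrow a T = ∀ i i′ → Crossing T a i → Crossing T a i′ → i ≡ i′

    crossing? : ∀ T a → Decidable (Crossing T a)
    crossing? T a i = Fin.any? λ x → Fin.any? λ y →
      (toℕ x ℕ.≟ a) ×-dec (toℕ y ℕ.≟ suc a) ×-dec adjacent? G T _ _

    narrow? : ∀ a T → Dec (Narrow a T)
    narrow? a T = Fin.all? λ i → Fin.all? λ i′ →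
      crossing? T a i →-dec crossing? T a i′ →-dec (i Fin.≟ i′)

    module Window (j : Fin (suc q)) where

      removed window : List (V G × V G)
      removed = map (λ i → verₑ (fsuc i) j) (allFin p)
      window  = map (λ i → horₑ i (inject₁ j)) (allFin n) ++ map (λ i → horₑ i (fsuc j)) (allFin n) ++
                map (λ i → verₑ i j) (allFin n)

      private
        allFin-length : ∀ {A : Set} (f : Fin n → A) → length (map f (allFin n)) ≡ n
        allFin-length f = trans (length-map f (allFin n)) (length-tabulate {n = n} id)

      length-window : length window ≡ n + (n + n)
      length-window = trans (length-++ (map (λ i → horₑ i (inject₁ j)) (allFin n)))
        (cong₂ _+_ (allFin-length _) (trans (length-++ (map (λ i → horₑ i (fsuc j)) (allFin n)))
          (cong₂ _+_ (allFin-length _) (allFin-length _))))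

      lower∈window : ∀ i → horₑ i (inject₁ j) ∈ window
      lower∈window i = ∈-++⁺ˡ (∈-map⁺ (λ i → horₑ i (inject₁ j)) (∈-allFin i))

      upper∈window : ∀ i → horₑ i (fsuc j) ∈ window
      upper∈window i = ∈-++⁺ʳ (map (λ i → horₑ i (inject₁ j)) (allFin n))
        (∈-++⁺ˡ (∈-map⁺ (λ i → horₑ i (fsuc j)) (∈-allFin i)))

      rung∈window : ∀ i → verₑ i j ∈ window
      rung∈window i = ∈-++⁺ʳ (map (λ i → horₑ i (inject₁ j)) (allFin n))
        (∈-++⁺ʳ (map (λ i → horₑ i (fsuc j)) (allFin n)) (∈-map⁺ (λ i → verₑ i j) (∈-allFin i)))

      hor∉removed : ∀ {i j′} → horₑ i j′ ∉ removed
      hor∉removed hor∈ with ∈-map⁻ (λ i → verₑ (fsuc i) j) hor∈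
      ... | _ , _ , eq = hor≢ver {j′ = j} eq

      rung₀∉removed : verₑ fzero j ∉ removed
      rung₀∉removed rung∈ with ∈-map⁻ (λ i → verₑ (fsuc i) j) rung∈
      ... | _ , _ , ()

      window-heights : ∀ {u v} → (u , v) ∈ window →
                       height u ≡ height v ⊎ (height u ≡ toℕ j × height v ≡ suc (toℕ j))
      window-heights uv∈ with ∈-++⁻ (map (λ i → horₑ i (inject₁ j)) (allFin n)) uv∈
      window-heights uv∈ | inj₁ uv∈′ with ∈-map⁻ (λ i → horₑ i (inject₁ j)) uv∈′
      ... | _ , _ , refl = inj₁ refl
      window-heights uv∈ | inj₂ uv∈′ with ∈-++⁻ (map (λ i → horₑ i (fsuc j)) (allFin n)) uv∈′
      window-heights uv∈ | inj₂ uv∈′ | inj₁ uv∈″ with ∈-map⁻ (λ i → horₑ i (fsuc j)) uv∈″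
      ... | _ , _ , refl = inj₁ refl
      window-heights uv∈ | inj₂ uv∈′ | inj₂ uv∈″ with ∈-map⁻ (λ i → verₑ i j) uv∈″
      ... | _ , _ , refl = inj₂ (Fin.toℕ-inject₁ j , refl)

      open DecMembership (≡-dec (Graph._≟_ G) (Graph._≟_ G)) using (_∈?_; _∉?_)

      -- Edges of the window either stay on a ring or climb level `j`. A crossing of any other level
      -- therefore uses an edge on which the two subgraphs agree.
      agree⇒crossing : ∀ {T T′ b} → AgreeOff G window T T′ → b ≢ toℕ j → ∀ i →
                       (Crossing T b i → Crossing T′ b i) × (Crossing T′ b i → Crossing T b i)
      agree⇒crossing {T} {T′} {b} agree b≢ i =
        (λ (x , y , x≡ , y≡ , e , e∈ , ends) →
          x , y , x≡ , y≡ , e , proj₁ (agree e (outside-window e ends x≡ y≡)) e∈ , ends) ,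
        (λ (x , y , x≡ , y≡ , e , e∈ , ends) →
          x , y , x≡ , y≡ , e , proj₂ (agree e (outside-window e ends x≡ y≡)) e∈ , ends)
        where
        outside-window : ∀ e {x y} → Ends G e (just (i , x)) (just (i , y)) →
                         toℕ x ≡ b → toℕ y ≡ suc b → lookup edges e ∉ window
        outside-window e (inj₁ eq) refl y≡ e∈ with window-heights (subst (_∈ window) eq e∈)
        ... | inj₁ x≡y       = 1+n≢n (sym (trans x≡y y≡))
        ... | inj₂ (x≡j , _) = b≢ x≡j
        outside-window e (inj₂ eq) refl y≡ e∈ with window-heights (subst (_∈ window) eq e∈)
        ... | inj₁ y≡x         = 1+n≢n (trans (sym y≡) y≡x)
        ... | inj₂ (y≡j , x≡1+j) = n≢2+n (trans (trans (sym y≡j) y≡) (cong suc x≡1+j))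

      agree⇒narrow : ∀ {T T′ b} → AgreeOff G window T T′ → b ≢ toℕ j → Narrow b T′ → Narrow b T
      agree⇒narrow {T} {T′} agree b≢ narrow i i′ c c′ =
        narrow i i′ (proj₁ (agree⇒crossing {T} {T′} agree b≢ i) c)
                    (proj₁ (agree⇒crossing {T} {T′} agree b≢ i′) c′)

      -- Completing both rings is what allows all rungs but one to be dropped without losing
      -- connectivity. Cycles may arise; they are removed in `narrowing`.
      Opened : Subgraph G → Pred (Edge G) 0ℓ
      Opened T e = (lookup edges e ∈ window × lookup edges e ∉ removed) ⊎ (lookup edges e ∉ window × e ∈ₛ T)

      opened? : ∀ T → Decidable (Opened T)
      opened? T e = (lookup edges e ∈? window ×-dec lookup edges e ∉? removed) ⊎-dec
                    (lookup edges e ∉? window ×-dec e Subset.∈? T)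

      next-inject₁ : ∀ (i : Fin p) → next (inject₁ i) ≡ fsuc i
      next-inject₁ i = Fin.toℕ-injective (trans (Fin.toℕ-fromℕ< _)
        (trans (m<n⇒m%n≡m (s≤s (≤-trans (≤-reflexive (cong suc (Fin.toℕ-inject₁ i))) (Fin.toℕ<n i))))
               (cong suc (Fin.toℕ-inject₁ i))))

      module _ (T : Subgraph G) where

        U : Subgraph G
        U = ⟪ opened? T ⟫

        U-adjacent : ∀ {u v} → (u , v) ∈ edges → (u , v) ∈ window → (u , v) ∉ removed → Adjacent G U u v
        U-adjacent uv∈ w∈ r∉ = Any.index uv∈ ,
          ∈-⟪⟫⁺ (opened? T) (inj₁ (subst (_∈ window) eq w∈ , r∉ ∘ subst (_∈ removed) (sym eq))) ,
          inj₁ (sym eq)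
          where eq = Any.lookup-index uv∈

        -- Only the rung at column 0 is kept, so the rungs are reached by going
        -- around both rings.
        rung : ∀ i → Star (Adjacent G U) (just (i , inject₁ j)) (just (i , fsuc j))
        rung = Fin.<-weakInduction _
          (U-adjacent (ver∈ fzero j) (rung∈window fzero) rung₀∉removed ◅ ε)
          λ i ih → subst (λ i′ → Star (Adjacent G U) (just (i′ , inject₁ j)) (just (i′ , fsuc j)))
                         (next-inject₁ i)
            (adjacent-sym G {U}
               (U-adjacent (hor∈ (inject₁ i) (inject₁ j)) (lower∈window (inject₁ i))
                           (hor∉removed {inject₁ i} {inject₁ j})) ◅
             ih ◅◅
             (U-adjacent (hor∈ (inject₁ i) (fsuc j)) (upper∈window (inject₁ i))
                         (hor∉removed {inject₁ i} {fsuc j}) ◅ ε))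

        U-connected : Connected G T → Connected G U
        U-connected = connected-by G {T} {U} detour
          where
          rungs : ∀ {uv} → uv ∈ removed → Star (Adjacent G U) (proj₁ uv) (proj₂ uv)
          rungs uv∈ with ∈-map⁻ (λ i → verₑ (fsuc i) j) uv∈
          ... | i , _ , refl = rung (fsuc i)

          detour : ∀ {e u v} → e ∈ₛ T → Ends G e u v → Star (Adjacent G U) u v
          detour {e} e∈T ends with lookup edges e ∈? window | lookup edges e ∈? removed
          detour {e} e∈T ends | no e∉w | _ = (e , ∈-⟪⟫⁺ (opened? T) (inj₂ (e∉w , e∈T)) , ends) ◅ ε
          detour {e} e∈T ends | yes e∈w | no e∉r = (e , ∈-⟪⟫⁺ (opened? T) (inj₁ (e∈w , e∉r)) , ends) ◅ ε
          detour {e} e∈T (inj₁ eq) | yes _ | yes e∈r = rungs (subst (_∈ removed) eq e∈r)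
          detour {e} e∈T (inj₂ eq) | yes _ | yes e∈r =
            Star.reverse (adjacent-sym G {U}) (rungs (subst (_∈ removed) eq e∈r))

        U-rung : ∀ {e i} → e ∈ₛ U → lookup edges e ≡ verₑ i j → i ≡ fzero
        U-rung {i = fzero}  e∈U eq = refl
        U-rung {i = fsuc i} e∈U eq with ∈-⟪⟫⁻ (opened? T) e∈U
        ... | inj₁ (_ , e∉r) = contradiction
                (subst (_∈ removed) (sym eq) (∈-map⁺ (λ i → verₑ (fsuc i) j) (∈-allFin i))) e∉r
        ... | inj₂ (e∉w , _) = contradiction (subst (_∈ window) (sym eq) (rung∈window (fsuc i))) e∉w

        U-crossing : ∀ {T′} → T′ ⊆ U → ∀ i → Crossing T′ (toℕ j) i → i ≡ fzero
        U-crossing T′⊆U i (x , y , x≡ , y≡ , e , e∈T′ , inj₂ eq) =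
          contradiction (trans y≡ (cong suc (sym x≡))) (kind-not-down (edge-kind (∈-lookup e)) eq)
        U-crossing T′⊆U i (x , y , x≡ , y≡ , e , e∈T′ , inj₁ eq)
          with kind-up (edge-kind (∈-lookup e)) eq (trans y≡ (cong suc (sym x≡)))
        ... | _ , j′ , eq′ , refl = U-rung {e} (T′⊆U e∈T′)
          (trans eq′ (cong (verₑ i) (Fin.toℕ-injective (trans (sym (Fin.toℕ-inject₁ j′)) x≡))))

        -- Off the window `U` consists of edges of `T`, so `T` itself serves as the acyclic part and
        -- only window edges are pruned. This yields the agreement off the window, while narrowness
        -- passes from `U` to its subgraph `T′`.
        narrowing : IsSpanningTree G T → ∃ λ T′ → IsSpanningTree G T′ × Narrow (toℕ j) T′ × AgreeOff G window T T′
        narrowing (conn , acyclic) = T′ , tree ,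
          (λ i i′ c c′ → trans (U-crossing {T′} T′⊆U i c) (sym (U-crossing {T′} T′⊆U i′ c′))) ,
          λ e e∉w → (λ e∈T → T′-keeps (∈-⟪⟫⁺ (opened? T) (inj₂ (e∉w , e∈T)))
                                      (e∉w ∘ proj₂ ∘ ∈-filter⁻ window? {xs = allFin _})) ,
                    (λ e∈T′ → [ (λ (e∈w , _) → contradiction e∈w e∉w) , proj₂ ]′ (∈-⟪⟫⁻ (opened? T) (T′⊆U e∈T′)))
          where
          window? : Decidable (λ e → lookup edges e ∈ window)
          window? e = lookup edges e ∈? window

          es : List (Edge G)
          es = filter window? (allFin _)

          extension : ∃ λ T′ → IsSpanningTree G T′ × T′ ⊆ U × (∀ {e} → e ∈ₛ U → e ∉ es → e ∈ₛ T′)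
          extension = extend-to-tree G U T es (U-connected conn) acyclic λ {e} e∈U →
            [ (λ (e∈w , _) → inj₁ (∈-filter⁺ window? (∈-allFin e) e∈w)) , inj₂ ∘ proj₂ ]′ (∈-⟪⟫⁻ (opened? T) e∈U)

          T′ : Subgraph G
          T′ = proj₁ extension
          tree : IsSpanningTree G T′
          tree = proj₁ (proj₂ extension)
          T′⊆U : T′ ⊆ U
          T′⊆U = proj₁ (proj₂ (proj₂ extension))
          T′-keeps : ∀ {e} → e ∈ₛ U → e ∉ es → e ∈ₛ T′
          T′-keeps = proj₂ (proj₂ (proj₂ extension))

    open Runs {A = Subgraph (wiredCylinder n m)} Narrow narrow?

    none-agree : ∀ j a k {T T′} → (∀ b → b ≢ j → Narrow b T′ → Narrow b T) → a + k ≤ j → None a k T → None a k T′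
    none-agree j a zero    f _  _        = _
    none-agree j a (suc k) f ≤j (n , ¬e) =
      none-agree j a k f (≤-trans (+-monoʳ-≤ a (n≤1+n k)) ≤j) n ,
      ¬e ∘ f (a + k) (<⇒≢ (≤-trans (≤-reflexive (sym (+-suc a k))) ≤j))

    narrowable : ∀ (j : Fin (suc q)) a k → toℕ j ≡ a + k → ∀ T → IsSpanningTree G T → None a (suc k) T →
                 ∃ λ T′ → IsSpanningTree G T′ × NoneThen a k T′ × AgreeOff G (Window.window j) T T′
    narrowable j a k j≡ T tree (no-narrow , _) = let T′ , tree′ , narrow , agree = Window.narrowing j T tree in
        T′ , tree′ ,
        (none-agree (toℕ j) a k {T} {T′} (λ b → Window.agree⇒narrow j {T} {T′} agree) (≤-reflexive (sym j≡)) no-narrow ,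
         subst (λ b → Narrow b T′) j≡ narrow) , agree

    -- Runs are allowed to extend beyond the top ring. Since nonexistent levels count as narrow,
    -- such runs never count as bad.
    vacuously-narrow : ∀ a → ¬ a < suc q → ∀ T → Narrow a T
    vacuously-narrow a a≮ T i i′ (x , y , _ , y≡ , _) =
      contradiction (s≤s⁻¹ (≤-trans (≤-reflexive (cong suc (sym y≡))) (Fin.toℕ<n y))) a≮

    -- Narrowing level `a + k` sends trees counted on the left to trees counted on the right: the
    -- earlier levels of the run lie off the window and keep their status. If that level does not
    -- exist, nothing is counted on the left.
    narrow-step : ∀ a k → count (none? a (suc k)) (spanningTrees (wiredCylinder n m)) ≤
                  2 ^ (n + (n + n)) * count (noneThen? a k) (spanningTrees (wiredCylinder n m))
    narrow-step a k = by-cases (a + k <? suc q)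
      where
      by-cases : Dec (a + k < suc q) →
                 count (none? a (suc k)) (spanningTrees (wiredCylinder n m)) ≤
                 2 ^ (n + (n + n)) * count (noneThen? a k) (spanningTrees (wiredCylinder n m))
      by-cases (yes a+k<) = ≤-trans
        (modification-count (wiredCylinder n m) edges-unique
          {None a (suc k)} {NoneThen a k} (none? a (suc k)) (noneThen? a k)
          (Window.window j) (narrowable j a k (Fin.toℕ-fromℕ< a+k<)))
        (≤-reflexive (cong (λ w → 2 ^ w * count (noneThen? a k) (spanningTrees (wiredCylinder n m)))
                           (Window.length-window j)))
        where
        j : Fin (suc q)
        j = fromℕ< a+k<
      by-cases (no a+k≮) = ≤-trans
        (≤-reflexive (count-none (none? a (suc k)) (λ T none → proj₂ none (vacuously-narrow (a + k) a+k≮ T))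
                                 (spanningTrees (wiredCylinder n m))))
        z≤n

    full-adjacent : ∀ {u v} → (u , v) ∈ Graph.edges G → Adjacent G full u v
    full-adjacent uv∈ = Any.index uv∈ , Subset.∈⊤ , inj₁ (sym (Any.lookup-index uv∈))

    full⇒sink : ∀ v → Star (Adjacent G full) v nothing
    full⇒sink nothing        = ε
    full⇒sink (just (i , j)) = Fin.<-weakInduction (λ j → Star (Adjacent G full) (just (i , j)) nothing)
      (adjacent-sym G {full} (full-adjacent (spoke∈ i)) ◅ ε)
      (λ j → adjacent-sym G {full} (full-adjacent (ver∈ i j)) ◅_) j

    full-connected : Connected G full
    full-connected u v = full⇒sink u ◅◅ Star.reverse (adjacent-sym G {full}) (full⇒sink v)

  -- A discrete intermediate value theorem: the first step to leave the region of height at most `a`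
  -- must rise from `a` to exactly `suc a`, as no step rises by more than one.
  star-crosses : {A : Set} {R : Rel A 0ℓ} (h : A → ℕ) → (∀ {x y} → R x y → h y ≤ suc (h x)) →
                 ∀ {u v a} → Star R u v → h u ≤ a → a < h v →
                 ∃₂ λ x y → R x y × h x ≡ a × h y ≡ suc a
  star-crosses h step ε u≤a a<v = contradiction u≤a (<⇒≱ a<v)
  star-crosses h step {a = a} (_◅_ {u} {w} r s) u≤a a<v with h w ≤? a
  ... | yes w≤a = star-crosses h step s w≤a a<v
  ... | no  w≰a = u , w , r , u≡a , trans w≡ (cong suc u≡a)
    where
    u≡a : h u ≡ a
    u≡a = ≤-antisym u≤a (s≤s⁻¹ (≤-trans (≰⇒> w≰a) (step r)))
    w≡ : h w ≡ suc (h u)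
    w≡ = ≤-antisym (step r) (≤-trans (≤-reflexive (cong suc u≡a)) (≰⇒> w≰a))

  -- Building a sink-trunk that crosses all levels but one.

  module Trunk (p q : ℕ) (T : Subgraph (wiredCylinder (suc p) (suc (suc q))))
               (connected : Connected (wiredCylinder (suc p) (suc (suc q))) T) where
    open Cylinder p q

    Grid : Rel (V G) 0ℓ
    Grid = AdjacentOutside G T (nothing ∷ [])

    grid-sym : ∀ {u v} → Grid u v → Grid v u
    grid-sym (u∉ , v∉ , adj) = v∉ , u∉ , adjacent-sym G {T} adj

    CrossBy : Rel (V G) 0ℓ → ℕ → Set
    CrossBy R a = ∃ λ i → ∃₂ λ x y → toℕ x ≡ a × toℕ y ≡ suc a × R (just (i , x)) (just (i , y))

    kind-height : ∀ {u v} → Kind (just u , just v) →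
                  height (just v) ≤ suc (height (just u)) × height (just u) ≤ suc (height (just v))
    kind-height (hor i j) = n≤1+n _ , n≤1+n _
    kind-height (ver i j) = ≤-reflexive (cong suc (sym (Fin.toℕ-inject₁ j))) ,
                            ≤-trans (≤-reflexive (Fin.toℕ-inject₁ j)) (≤-trans (n≤1+n _) (n≤1+n _))

    grid-step : ∀ {u v} → Grid u v → height v ≤ suc (height u)
    grid-step {nothing} (u∉ , _) = contradiction (here refl) u∉
    grid-step {just _} {nothing} (_ , v∉ , _) = contradiction (here refl) v∉
    grid-step {just _} {just _} (_ , _ , e , _ , ends) with ends-kind {e} ends
    ... | inj₁ kind = proj₁ (kind-height kind)
    ... | inj₂ kind = proj₂ (kind-height kind)

    grid-column : ∀ {i x i′ y} → Grid (just (i , x)) (just (i′ , y)) → toℕ y ≡ suc (toℕ x) → i ≡ i′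
    grid-column (_ , _ , e , _ , ends) y≡ with ends-kind {e} ends
    ... | inj₁ kind = proj₁ (kind-up kind refl y≡)
    ... | inj₂ kind = contradiction y≡ (kind-not-down kind refl)

    crosses : ∀ {R : Rel (V G) 0ℓ} {u v a} → (∀ {x y} → R x y → Grid x y) → Star R u v →
              height u ≤ a → a < height v → CrossBy R a
    crosses R⇒Grid star u≤a a<v with star-crosses height (grid-step ∘ R⇒Grid) star u≤a a<v
    ... | nothing       , _             , r , _  , _  = contradiction (here refl) (proj₁ (R⇒Grid r))
    ... | just _        , nothing       , r , _  , _  = contradiction (here refl) (proj₁ (proj₂ (R⇒Grid r)))
    ... | just (i , x)  , just (i′ , y) , r , x≡ , y≡ with grid-column (R⇒Grid r) (trans y≡ (cong suc (sym x≡)))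
    ...   | refl = i , x , y , x≡ , y≡ , r

    -- Membership of both ends is recorded because the clash with a branch is derived from a vertex:
    -- the lower end of a crossing edge must lie on the trunk.
    Within : List (V G) → Rel (V G) 0ℓ
    Within P x y = Grid x y × x ∈ P × y ∈ P

    within-sym : ∀ {P x y} → Within P x y → Within P y x
    within-sym (g , x∈ , y∈) = grid-sym g , y∈ , x∈

    record Path (u v : V G) : Set where
      field
        path      : List (V G)
        unique    : Unique path
        linked    : Linked Grid path
        head≡     : head path ≡ just u
        last≡     : last path ≡ just v
        reachable : All (Star Grid u) path
        within    : Star (Within path) u v

    star⇒path : ∀ {u v} → Star Grid u v → Path u v
    star⇒path star with star⇒joins G star
    ... | (u ∷ us) , unique , refl , last≡ , linked = record
      { path = u ∷ us ; unique = unique ; linked = linked ; head≡ = refl ; last≡ = last≡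
      ; reachable = All-link (λ s r → s ◅◅ (r ◅ ε)) ε linked
      ; within = linked⇒star (λ x∈ y∈ g → g , x∈ , y∈) us linked (All.tabulate id) last≡ }

    -- These label the components of `T` off the sink by the ring through which they hang from the
    -- sink. A path of low vertices and a path of vertices that are not low are automatically
    -- disjoint, so they can be joined at the sink into a simple path.
    LowReach HighReach : Pred (V G) 0ℓ
    LowReach  u = ∃ λ i → Adjacent G T (just (i , fzero)) nothing × Star Grid u (just (i , fzero))
    HighReach u = ∃ λ i → Adjacent G T (just (i , fromℕ (suc q))) nothing × Star Grid u (just (i , fromℕ (suc q)))

    lowReach? : Decidable LowReach
    lowReach? u = Fin.any? λ i → adjacent? G T _ _ ×-dec sameComponent? G T (nothing ∷ []) u _

    just∉sink : ∀ {u : Fin n × Fin m} → just u ∉ nothing ∷ []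
    just∉sink (there ())

    star⇒reach : ∀ {u} → Star (Adjacent G T) (just u) nothing →
                 ∃ λ w → Adjacent G T (just w) nothing × Star Grid (just u) (just w)
    star⇒reach (_◅_ {j = nothing} adj _) = _ , adj , ε
    star⇒reach (_◅_ {j = just v}  adj s) with star⇒reach s
    ... | w , adj′ , star = w , adj′ , (just∉sink , just∉sink , adj) ◅ star

    -- A walk from `u` to the sink is followed until it first arrives there; the vertex before the
    -- sink lies in ring 0 or ring m - 1, because only these carry spokes.
    low-or-high : ∀ u → LowReach (just u) ⊎ HighReach (just u)
    low-or-high u = by-kind (star⇒reach (connected (just u) nothing))
      where
      by-kind : (∃ λ w → Adjacent G T (just w) nothing × Star Grid (just u) (just w)) →
                LowReach (just u) ⊎ HighReach (just u)
      by-kind (w , adj@(e , _ , ends) , star) with ends-kind {e} ends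
      ... | inj₂ (spoke i (inj₁ refl)) = inj₁ (i , adj , star)
      ... | inj₂ (spoke i (inj₂ refl)) = inj₂ (i , adj , star)

    -- The part of the trunk before the sink; `k` is the number of rings that it must cover from
    -- below. For `k = 0` the path may be empty, which is why the link to the sink is phrased with
    -- `Meets` on an optional last vertex.
    record Lower (k : ℕ) : Set where
      field
        path   : List (V G)
        unique : Unique path
        linked : Linked Grid path
        low    : All LowReach path
        to-sink : Meets (Adjacent G T) (last path) (just nothing)
        cross  : ∀ a → suc a < k → CrossBy (Within path) a
        cover  : ∀ j → toℕ j < k → ∃ λ i → just (i , j) ∈ path

    record Upper (k : ℕ) : Set where
      field
        path   : List (V G)
        unique : Unique path
        linked : Linked Grid path
        ¬low   : All (¬_ ∘ LowReach) path
        sink∉  : nothing ∉ path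
        from-sink : Meets (Adjacent G T) (just nothing) (head path)
        cross  : ∀ a → k ≤ a → suc a < m → CrossBy (Within path) a
        cover  : ∀ j → k ≤ toℕ j → ∃ λ i → just (i , j) ∈ path

    ¬sink-star : ∀ {u} → ¬ Star Grid nothing (just u)
    ¬sink-star (g ◅ _) = proj₁ g (here refl)

    meets⁺ˡ : ∀ {R : Rel (V G) 0ℓ} xs {x y} → last xs ≡ just x → R x y → Meets R (last xs) (just y)
    meets⁺ˡ xs eq r = subst (λ z → Meets _ z (just _)) (sym eq) (just r)

    meets⁺ʳ : ∀ {R : Rel (V G) 0ℓ} xs {x y} → head xs ≡ just y → R x y → Meets R (just x) (head xs)
    meets⁺ʳ xs eq r = subst (λ z → Meets _ (just _) z) (sym eq) (just r)

    cross⇒lower∈ : ∀ {P a} (j : Fin m) → toℕ j ≡ a → CrossBy (Within P) a → ∃ λ i → just (i , j) ∈ P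
    cross⇒lower∈ {P} j j≡ (i , x , _ , x≡ , _ , _ , x∈ , _) =
      i , subst (λ x → just (i , x) ∈ P) (Fin.toℕ-injective (trans x≡ (sym j≡))) x∈

    lower-zero : Lower 0
    lower-zero = record
      { path = [] ; unique = [] ; linked = [] ; low = [] ; to-sink = nothing-just
      ; cross = λ _ () ; cover = λ _ () }

    lower-suc : ∀ j → LowReach (just (fzero , j)) → Lower (suc (toℕ j))
    lower-suc j (i , adj , star) = record
      { path = path ; unique = unique ; linked = linked
      ; low = All.map (λ r → i , adj , Star.reverse grid-sym r ◅◅ star) reachable
      ; to-sink = meets⁺ˡ path last≡ adj
      ; cross = cross
      ; cover = cover }
      where
      open Path (star⇒path star)

      cross : ∀ a → suc a < suc (toℕ j) → CrossBy (Within path) a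
      cross a (s≤s a<j) = crosses proj₁ (Star.reverse within-sym within) z≤n a<j

      cover : ∀ k → toℕ k < suc (toℕ j) → ∃ λ i → just (i , k) ∈ path
      cover k (s≤s k≤j) = by-cases (m≤n⇒m<n∨m≡n k≤j)
        where
        by-cases : toℕ k < toℕ j ⊎ toℕ k ≡ toℕ j → ∃ λ i → just (i , k) ∈ path
        by-cases (inj₁ k<j) = cross⇒lower∈ k refl (cross (toℕ k) (s≤s k<j))
        by-cases (inj₂ k≡j) = fzero , subst (λ k → just (fzero , k) ∈ path) (sym (Fin.toℕ-injective k≡j)) (head-∈ path head≡)

    upper-m : Upper m
    upper-m = record
      { path = [] ; unique = [] ; linked = [] ; ¬low = [] ; sink∉ = λ () ; from-sink = just-nothing
      ; cross = λ a m≤a a<m → contradiction (≤-trans (n≤1+n _) a<m) (≤⇒≯ m≤a)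
      ; cover = λ j m≤j → contradiction (Fin.toℕ<n j) (≤⇒≯ m≤j) }

    upper : ∀ j → ¬ LowReach (just (fzero , j)) → HighReach (just (fzero , j)) → Upper (toℕ j)
    upper j ¬lowⱼ (i , adj , star) = record
      { path = path ; unique = unique ; linked = linked
      ; ¬low = All.map (λ r (i′ , adj′ , s) → ¬lowⱼ (i′ , adj′ , star ◅◅ r ◅◅ s)) reachable
      ; sink∉ = λ s∈ → ¬sink-star (Star.reverse grid-sym (All.lookup reachable s∈))
      ; from-sink = meets⁺ʳ path head≡ (adjacent-sym G {T} adj)
      ; cross = cross
      ; cover = cover }
      where
      -- This half comes after the sink in the trunk, so it has to start at the top ring and end at
      -- column 0.
      open Path (star⇒path (Star.reverse grid-sym star))

      cross : ∀ a → toℕ j ≤ a → suc a < m → CrossBy (Within path) a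
      cross a j≤a a<m = crosses proj₁ (Star.reverse within-sym within) j≤a
        (≤-trans (s≤s⁻¹ a<m) (≤-reflexive (sym (Fin.toℕ-fromℕ (suc q)))))

      cover : ∀ k → toℕ j ≤ toℕ k → ∃ λ i → just (i , k) ∈ path
      cover k j≤k = by-cases (m≤n⇒m<n∨m≡n (Fin.toℕ<n k))
        where
        by-cases : suc (toℕ k) < m ⊎ suc (toℕ k) ≡ m → ∃ λ i → just (i , k) ∈ path
        by-cases (inj₁ k<) = cross⇒lower∈ k refl (cross (toℕ k) j≤k k<)
        by-cases (inj₂ k≡) = i , subst (λ k → just (i , k) ∈ path)
          (Fin.toℕ-injective (trans (Fin.toℕ-fromℕ (suc q)) (sym (suc-injective k≡)))) (head-∈ path head≡)

    -- Column 0 is climbed as long as its vertices are low, each one replacing the lower half by its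
    -- own path to ring 0. The first vertex that is not low is high and provides the upper half; if
    -- there is none, the upper half is empty. The counter `d` is the number of rings left.
    halves : ∀ d k → k + d ≡ m → Lower k → ∃ λ k → Lower k × Upper k
    halves zero    k k≡m lower = k , lower , subst Upper (trans (sym k≡m) (+-identityʳ k)) upper-m
    halves (suc d) k k≡m lower = by-cases (lowReach? (just (fzero , j)))
      where
      k<m : k < m
      k<m = ≤-trans (m≤m+n (suc k) d) (≤-reflexive (trans (sym (+-suc k d)) k≡m))

      j : Fin m
      j = fromℕ< k<m

      j≡k : toℕ j ≡ k
      j≡k = Fin.toℕ-fromℕ< k<m

      by-cases : Dec (LowReach (just (fzero , j))) → ∃ λ k → Lower k × Upper k
      by-cases (yes low) = halves d (suc k) (trans (sym (+-suc k d)) k≡m) (subst (Lower ∘ suc) j≡k (lower-suc j low))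
      by-cases (no ¬low) = k , lower , subst Upper j≡k (upper j ¬low
        ([ (λ low → contradiction low ¬low) , id ]′ (low-or-high (fzero , j))))

    -- The one level that need not be crossed lies between rings gap - 1 and gap.
    record CrossingTrunk : Set where
      field
        L           : List (V G)
        isSinkTrunk : IsSinkTrunk n m T L
        gap         : ℕ
        cross       : ∀ a → suc a < m → suc a ≢ gap → CrossBy (Within L) a

    within-mono : ∀ {P L a} → (∀ {x} → x ∈ P → x ∈ L) → CrossBy (Within P) a → CrossBy (Within L) a
    within-mono f (i , x , y , x≡ , y≡ , g , x∈ , y∈) = i , x , y , x≡ , y≡ , g , f x∈ , f y∈

    join : ∀ {k} → Lower k → Upper k → CrossingTrunk
    join {k} lower upper = record
      { L = L
      ; isSinkTrunk = ((L-unique , L-linked) , L-cover) , ∈-++⁺ʳ P.path (here refl)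
      ; gap = k
      ; cross = λ a a<m a≢ → [ (λ a<k → within-mono P⊆L (P.cross a a<k)) ,
                              (λ k<a → within-mono Q⊆L (Q.cross a (s≤s⁻¹ k<a) a<m)) ]′ (≢⇒<⊎> a≢) }
      where
      module P = Lower lower
      module Q = Upper upper

      L : List (V G)
      L = P.path ++ nothing ∷ Q.path

      P⊆L : ∀ {x} → x ∈ P.path → x ∈ L
      P⊆L = ∈-++⁺ˡ

      Q⊆L : ∀ {x} → x ∈ Q.path → x ∈ L
      Q⊆L = ∈-++⁺ʳ P.path ∘ there

      ≢⇒<⊎> : ∀ {a} → suc a ≢ k → suc a < k ⊎ k < suc a
      ≢⇒<⊎> {a} a≢ with <-cmp (suc a) k
      ... | tri< lt _ _ = inj₁ lt
      ... | tri≈ _ eq _ = contradiction eq a≢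
      ... | tri> _ _ gt = inj₂ gt

      sink∉Q : All (nothing ≢_) Q.path
      sink∉Q = All.tabulate λ x∈ eq → Q.sink∉ (subst (_∈ Q.path) (sym eq) x∈)

      disjoint : ∀ {x} → x ∈ P.path × x ∈ nothing ∷ Q.path → ⊥
      disjoint (x∈P , here refl) = ¬sink-star (proj₂ (proj₂ (All.lookup P.low x∈P)))
      disjoint (x∈P , there x∈Q) = All.lookup Q.¬low x∈Q (All.lookup P.low x∈P)

      L-unique : Unique L
      L-unique = Unique.++⁺ P.unique (sink∉Q ∷ Q.unique) disjoint

      L-linked : Linked (Adjacent G T) L
      L-linked = Linked.++⁺ (Linked.map (proj₂ ∘ proj₂) P.linked) P.to-sink
                            (Q.from-sink ∷′ Linked.map (proj₂ ∘ proj₂) Q.linked)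

      L-cover : ∀ j → ∃ λ i → just (i , j) ∈ L
      L-cover j with toℕ j <? k
      ... | yes j<k = let i , ∈P = P.cover j j<k in i , P⊆L ∈P
      ... | no  j≮k = let i , ∈Q = Q.cover j (≮⇒≥ j≮k) in i , Q⊆L ∈Q

    crossingTrunk : CrossingTrunk
    crossingTrunk = let _ , lower , upper = halves m 0 refl lower-zero in join lower upper

    walk⁺ : ∀ {x z w} xs → Linked (Adjacent G T) (x ∷ xs) → last (x ∷ xs) ≡ just z →
            Adjacent G T z w → Walk G T (length (x ∷ xs)) x w
    walk⁺ []       [-]      refl adj = _ , adj , refl
    walk⁺ (y ∷ ys) (r ∷ rs) eq   adj = y , r , walk⁺ ys rs eq adj

    -- The bound on `k` is there because `dist` inspects only lengths below the number of vertices.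
    walk⇒dist≤ : ∀ {k u v} → k < length (Graph.vertices G) → Walk G T k u v → dist G T u v ≤ k
    walk⇒dist≤ {k} {u} {v} k< walk =
      Extrema.min≤v⁺ (length (Graph.vertices G)) _
        (inj₂ (lose (∈-filter⁺ (λ k → walk? G T k u v) (∈-upTo⁺ k<) walk) ≤-refl))

    -- A vertex is encoded by its column and its height relative to `h`, shifted by `b` so that this
    -- offset is a natural number below `b + b`.
    strip-length : ∀ {b h P} → Unique P → nothing ∉ P →
                   All (λ x → height x < h + b × h < height x + b) P → length P ≤ n * (b + b)
    strip-length {b} {h} {P} unique sink∉P strip = begin
      length P ≤⟨ length-injective R unique total injective ⟩
      length (cartesianProduct (allFin n) (upTo (b + b))) ≡⟨ length-cartesianProduct (allFin n) (upTo (b + b)) ⟩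
      length (allFin n) * length (upTo (b + b)) ≡⟨ cong₂ _*_ (length-tabulate {n = n} id) (length-upTo (b + b)) ⟩
      n * (b + b) ∎
      where
      open ≤-Reasoning
      R : V G → Fin n × ℕ → Set
      R x (i , d) = ∃ λ j → x ≡ just (i , j) × d + h ≡ toℕ j + b

      injective : ∀ {x x′ y} → R x y → R x′ y → x ≡ x′
      injective {y = i , _} (j , refl , eq) (j′ , refl , eq′) =
        cong (λ j → just (i , j)) (Fin.toℕ-injective (+-cancelʳ-≡ b (toℕ j) (toℕ j′) (trans (sym eq) eq′)))

      total : ∀ {x} → x ∈ P → ∃ λ y → y ∈ cartesianProduct (allFin n) (upTo (b + b)) × R x y
      total {nothing} x∈P = contradiction x∈P sink∉P
      total {just (i , j)} x∈P with All.lookup strip x∈P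
      ... | j< , <j = (i , toℕ j + b ∸ h) ,
        ∈-cartesianProduct⁺ (∈-allFin i) (∈-upTo⁺ (+-cancelʳ-< h _ _ (begin-strict
          toℕ j + b ∸ h + h ≡⟨ m∸n+n≡m (<⇒≤ <j) ⟩
          toℕ j + b         <⟨ +-monoˡ-< b j< ⟩
          h + b + b         ≡⟨ +-assoc h b b ⟩
          h + (b + b)       ≡⟨ +-comm h (b + b) ⟩
          b + b + h         ∎))) ,
        j , refl , m∸n+n≡m (<⇒≤ <j)

    -- Branches are stopped by narrow levels.

    open Runs {A = Subgraph (wiredCylinder n m)} Narrow narrow?

    module _ (trunk : CrossingTrunk) (N : ℕ) (frequent : ¬ SomeNone N m T) where

      open CrossingTrunk trunk

      Off : Rel (V G) 0ℓ
      Off = AdjacentOutside G T L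

      sink∈L : nothing ∈ L
      sink∈L = proj₂ isSinkTrunk

      off⇒grid : ∀ {x y} → Off x y → Grid x y
      off⇒grid (x∉ , y∉ , adj) = (λ { (here refl) → x∉ sink∈L }) , (λ { (here refl) → y∉ sink∈L }) , adj

      off-sym : ∀ {x y} → Off x y → Off y x
      off-sym (x∉ , y∉ , adj) = y∉ , x∉ , adjacent-sym G {T} adj

      -- Both crossings would lie in the same column, so they would share a lower end, which would
      -- be on `L` and off it at once.
      not-both : ∀ {a} → Narrow a T → CrossBy (Within L) a → ¬ CrossBy Off a
      not-both {a} narrow (i , x , y , x≡ , y≡ , (_ , _ , adj) , x∈L , _)
                          (i′ , x′ , y′ , x′≡ , y′≡ , x′∉L , _ , adj′) =
        x′∉L (subst (_∈ L)
          (cong₂ (λ i x → just (i , x))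
            (narrow i i′ (x , y , x≡ , y≡ , adj) (x′ , y′ , x′≡ , y′≡ , adj′))
            (Fin.toℕ-injective (trans x≡ (sym x′≡))))
          x∈L)

      ¬crosses-run : ∀ {u v} a → a + N ≤ height v → height v < m → height u ≤ a →
                     (∀ b → a ≤ b → b < a + N → suc b ≢ gap) → ¬ Star Off u v
      ¬crosses-run {u} {v} a a+N≤ v<m u≤a ≢gap star = narrow-level
        (¬none⇒event a N {T} (¬someNone⇒¬none N m frequent a (≤-trans (s≤s (≤-trans (m≤m+n a N) a+N≤)) v<m)))
        where
        narrow-level : ¬ ∃ λ b → a ≤ b × b < a + N × Narrow b T
        narrow-level (b , a≤b , b< , narrow) = not-both narrow
          (cross b (≤-trans (s≤s (≤-trans b< a+N≤)) v<m) (≢gap b a≤b b<))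
          (crosses off⇒grid star (≤-trans u≤a a≤b) (≤-trans b< a+N≤))

      height<m : ∀ u → height u < m
      height<m nothing        = s≤s z≤n
      height<m (just (_ , j)) = Fin.toℕ<n j

      -- Of two consecutive runs of N levels, at least one avoids the gap.
      off-height : ∀ {u v} → Star Off u v → height v < height u + (N + N)
      off-height {u} {v} star = ≰⇒> λ far → by-cases far (gap ≤? height u + N)
        where
        by-cases : height u + (N + N) ≤ height v → Dec (gap ≤ height u + N) → ⊥
        by-cases far (yes gap≤) = ¬crosses-run (height u + N)
          (≤-trans (≤-reflexive (+-assoc _ N N)) far) (height<m v) (m≤m+n _ N)
          (λ b a≤b _ eq → 1+n≰n (≤-trans (≤-reflexive eq) (≤-trans gap≤ a≤b))) star
        by-cases far (no gap≰) = ¬crosses-run (height u)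
          (≤-trans (+-monoʳ-≤ (height u) (m≤m+n N N)) far) (height<m v) ≤-refl
          (λ b _ b< eq → gap≰ (≤-trans (≤-reflexive (sym eq)) b<)) star

      -- The path to the link stays off `L`, so by `off-height`, used in both directions, it lies
      -- less than 2N above or below `v`. Appending the step to `a` makes the number of edges equal
      -- to the number of vertices of that path, at most 4nN. Since `a` is a further vertex, this
      -- number is within the range of `dist`.
      off-dist : ∀ {v w a} → Star Off v w → v ∉ L → a ∈ L → Adjacent G T w a →
                 dist G T v a ≤ n * (N + N + (N + N))
      off-dist {v} {w} {a} star v∉L a∈L adj with star⇒joins G star
      ... | (_ ∷ vs) , unique , refl , last≡ , linked = ≤-trans
        (walk⇒dist≤ (Unique⇒length≤ G (a∉P ∷ unique)) (walk⁺ vs (Linked.map (proj₂ ∘ proj₂) linked) last≡ adj))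
        (strip-length unique (λ s∈ → All.lookup P∉L s∈ sink∈L)
          (All.map (λ s → off-height s , off-height (Star.reverse off-sym s)) reachable))
        where
        reachable : All (Star Off v) (v ∷ vs)
        reachable = All-link (λ s r → s ◅◅ (r ◅ ε)) ε linked

        P∉L : All (_∉ L) (v ∷ vs)
        P∉L = All-link (λ _ r → proj₁ (proj₂ r)) v∉L linked

        a∉P : All (a ≢_) (v ∷ vs)
        a∉P = All.map (λ x∉L eq → x∉L (subst (_∈ L) eq a∈L)) P∉L

      hasShortBranches : ∀ {ℓ} → n * (N + N + (N + N)) < ℓ → HasSinkTrunkWithBranchesShorterThan n m T ℓ
      hasShortBranches {ℓ} short = L , isSinkTrunk , λ B → branch B
        where
        branch : (B : Branch G T L) → branchLength G B < ℓ
        branch B = Extrema.max<v⁺ (≤-trans (s≤s z≤n) short) (All.map⁺ (All.tabulate λ {v} v∈ →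
          bound v (proj₂ (∈-filter⁻ (sameComponent? G T L base) {xs = Graph.vertices G} v∈))))
          where
          open Branch B

          star-∉ : ∀ {v} → Star Off base v → v ∉ L
          star-∉ ε                   = base∉L
          star-∉ ((_ , y∉L , _) ◅ s) = last-∉ y∉L s
            where
            last-∉ : ∀ {y v} → y ∉ L → Star Off y v → v ∉ L
            last-∉ y∉L ε                   = y∉L
            last-∉ _   ((_ , z∉L , _) ◅ s) = last-∉ z∉L s

          bound : ∀ v → Star Off base v → dist G T v attachment < ℓ
          bound v s = ≤-trans (s≤s (off-dist (Star.reverse off-sym s ◅◅ link∈B)
            (star-∉ s) attachment∈L link-adj)) short

  -- The equations allow n and m to be replaced later without unfolding the list
  -- of spanning trees.
  resize-tree : ∀ n m {n′ m′} → n ≡ n′ → m ≡ m′ → (∃ λ T → T ∈ spanningTrees (wiredCylinder n m)) →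
                ∃ λ T → T ∈ spanningTrees (wiredCylinder n′ m′)
  resize-tree n m refl refl tree = tree

  resize-bound : ∀ n m {n′ m′} → n ≡ n′ → m ≡ m′ → ∀ N ℓ
    {Q : Pred (Subgraph (wiredCylinder n m)) 0ℓ} (Q? : Decidable Q) →
    (∀ {T} → T ∈ spanningTrees (wiredCylinder n m) →
      HasSinkTrunkWithBranchesShorterThan n m T ℓ ⊎ Q T) →
    count Q? (spanningTrees (wiredCylinder n m)) * suc (2 ^ (n + (n + n))) ^ N ≤
      m * ((2 ^ (n + (n + n))) ^ N * length (spanningTrees (wiredCylinder n m))) →
    ∃ λ b →
      length (spanningTrees (wiredCylinder n′ m′)) ≤
        count (λ T → hasSinkTrunkWithBranchesShorterThan? n′ m′ T ℓ) (spanningTrees (wiredCylinder n′ m′)) + b ×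
      b * suc (2 ^ (n′ + (n′ + n′))) ^ N ≤
        m′ * ((2 ^ (n′ + (n′ + n′))) ^ N * length (spanningTrees (wiredCylinder n′ m′)))
  resize-bound n m refl refl N ℓ Q? short-or-Q decay =
    count Q? (spanningTrees (wiredCylinder n m)) ,
    length≤count+count (λ T → hasSinkTrunkWithBranchesShorterThan? n m T ℓ) Q?
      (spanningTrees (wiredCylinder n m)) short-or-Q ,
    decay

  -- Counting the trees that may have long branches.

  module _ (p q : ℕ) where
    open Cylinder p q
    open Runs {A = Subgraph (wiredCylinder n m)} Narrow narrow?

    short-or-none : ∀ N ℓ → n * (N + N + (N + N)) < ℓ → ∀ {T} → T ∈ spanningTrees (wiredCylinder n m) →
                    HasSinkTrunkWithBranchesShorterThan n m T ℓ ⊎ SomeNone N m T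
    short-or-none N ℓ short {T} T∈ = by-cases (someNone? N m T)
      where
      open Trunk p q T
        (proj₁ (proj₂ (∈-filter⁻ (isSpanningTree? G) {xs = subsets (length (Graph.edges G))} T∈)))

      by-cases : Dec (SomeNone N m T) → HasSinkTrunkWithBranchesShorterThan n m T ℓ ⊎ SomeNone N m T
      by-cases (yes some) = inj₂ some
      by-cases (no ¬some) = inj₁ (hasShortBranches crossingTrunk N ¬some short)

    narrow-decay : ∀ N → count (someNone? N m) (spanningTrees (wiredCylinder n m)) * suc (2 ^ (n + (n + n))) ^ N ≤
      m * ((2 ^ (n + (n + n))) ^ N * length (spanningTrees (wiredCylinder n m)))
    narrow-decay N = someNone-decay (spanningTrees (wiredCylinder n m)) (2 ^ (n + (n + n))) narrow-step N m

    bounded : ∀ {n′ m′} → n ≡ n′ → m ≡ m′ → ∀ N ℓ → n * (N + N + (N + N)) < ℓ →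
      ∃ λ b →
        length (spanningTrees (wiredCylinder n′ m′)) ≤
          count (λ T → hasSinkTrunkWithBranchesShorterThan? n′ m′ T ℓ) (spanningTrees (wiredCylinder n′ m′)) + b ×
        b * suc (2 ^ (n′ + (n′ + n′))) ^ N ≤
          m′ * ((2 ^ (n′ + (n′ + n′))) ^ N * length (spanningTrees (wiredCylinder n′ m′)))
    bounded n≡ m≡ N ℓ short = resize-bound n m n≡ m≡ N ℓ {SomeNone N m} (someNone? N m)
      (short-or-none N ℓ short) (narrow-decay N)

    cylinder-tree : ∀ {n′ m′} → n ≡ n′ → m ≡ m′ → ∃ λ T → T ∈ spanningTrees (wiredCylinder n′ m′)
    cylinder-tree n≡ m≡ = resize-tree n m n≡ m≡ (spanning-tree-exists (wiredCylinder n m) full-connected)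

  tree-exists : ∀ n m → n ≥ 3 → m ≥ 2 → ∃ λ T → T ∈ spanningTrees (wiredCylinder n m)
  tree-exists (suc p) (suc (suc q)) _ _ = cylinder-tree p q {suc p} {suc (suc q)} refl refl
  tree-exists (suc p) (suc zero) _ (s≤s ())

  few-long-branches : ∀ n m → n ≥ 3 → m ≥ 2 → ∀ N ℓ → n * (N + N + (N + N)) < ℓ →
    ∃ λ b →
      length (spanningTrees (wiredCylinder n m)) ≤
        count (λ T → hasSinkTrunkWithBranchesShorterThan? n m T ℓ) (spanningTrees (wiredCylinder n m)) + b ×
      b * suc (2 ^ (n + (n + n))) ^ N ≤
        m * ((2 ^ (n + (n + n))) ^ N * length (spanningTrees (wiredCylinder n m)))
  few-long-branches (suc p) (suc (suc q)) _ _ = bounded p q {suc p} {suc (suc q)} refl refl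
  few-long-branches (suc p) (suc zero) _ (s≤s ())

-- From decay per level to decay per unit of length.

module Arithmetic where
  open import Data.Nat.Base
  open import Data.Nat.Properties hiding (_≟_)
  open import Data.Nat.DivMod using (_/_; _%_; m≡m%n+[m/n]*n; m%n<n)
  open import Data.Nat.Solver using (module +-*-Solver)
  open +-*-Solver

  -- The inequality (1 - 1/(s+1))^j ≥ 1 - j/(r+j), cleared of denominators. With x = r + j, the
  -- induction step is x + s x ≤ s (1 + x), which amounts to x ≤ s.
  bernoulli : ∀ s r j → r + j ≤ suc s → suc s ^ j * r ≤ s ^ j * (r + j)
  bernoulli s r zero    _  = ≤-reflexive (cong (1 *_) (sym (+-identityʳ r)))
  bernoulli s r (suc j) ≤s = begin
    suc s * suc s ^ j * r       ≡⟨ *-assoc (suc s) (suc s ^ j) r ⟩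
    suc s * (suc s ^ j * r)     ≤⟨ *-monoʳ-≤ (suc s) (bernoulli s r j (≤-trans (+-monoʳ-≤ r (n≤1+n j)) ≤s)) ⟩
    suc s * (s ^ j * (r + j))   ≡⟨ solve 3 (λ s e x → (con 1 :+ s) :* (e :* x) := e :* (x :+ s :* x)) refl s (s ^ j) (r + j) ⟩
    s ^ j * (r + j + s * (r + j)) ≤⟨ *-monoʳ-≤ (s ^ j) (+-monoˡ-≤ (s * (r + j)) r+j≤s) ⟩
    s ^ j * (s + s * (r + j))   ≡⟨ solve 4 (λ s e r j → e :* (s :+ s :* (r :+ j)) := s :* e :* (r :+ (con 1 :+ j))) refl s (s ^ j) r j ⟩
    s * s ^ j * (r + suc j)     ∎
    where
    open ≤-Reasoning
    r+j≤s : r + j ≤ s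
    r+j≤s = s≤s⁻¹ (≤-trans (≤-reflexive (sym (+-suc r j))) ≤s)

  -- For s = c (K + 1), Bernoulli's inequality gives (s / (s + 1))^c ≥ K / (K + 1):
  -- a rational replacement for the c-th root of the decay rate per run.
  rate : ∀ c K .{{_ : NonZero c}} → suc (c * suc K) ^ c * K ≤ (c * suc K) ^ c * suc K
  rate c K = *-cancelʳ-≤ _ _ c (begin
    suc s ^ c * K * c       ≡⟨ solve 3 (λ x K c → x :* K :* c := x :* (c :* K)) refl (suc s ^ c) K c ⟩
    suc s ^ c * (c * K)     ≤⟨ bernoulli s (c * K) c (≤-trans (≤-reflexive cK+c) (n≤1+n s)) ⟩
    s ^ c * (c * K + c)     ≡⟨ solve 3 (λ x K c → x :* (c :* K :+ c) := x :* (con 1 :+ K) :* c) refl (s ^ c) K c ⟩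
    s ^ c * suc K * c       ∎)
    where
    open ≤-Reasoning
    s = c * suc K
    cK+c : c * K + c ≡ s
    cK+c = trans (+-comm (c * K) c) (sym (*-suc c K))

  ^-distribʳ-* : ∀ a b k → (a * b) ^ k ≡ a ^ k * b ^ k
  ^-distribʳ-* a b zero    = refl
  ^-distribʳ-* a b (suc k) = trans (cong (a * b *_) (^-distribʳ-* a b k))
    (solve 4 (λ a b x y → a :* b :* (x :* y) := a :* x :* (b :* y)) refl a b (a ^ k) (b ^ k))

  module _ (c K s : ℕ) .{{_ : NonZero s}} (rate≤ : suc s ^ c * K ≤ s ^ c * suc K) where
    open ≤-Reasoning

    rate-power : ∀ k → suc s ^ (c * k) * K ^ k ≤ s ^ (c * k) * suc K ^ k
    rate-power k = begin
      suc s ^ (c * k) * K ^ k   ≡⟨ cong (_* K ^ k) (^-*-assoc (suc s) c k) ⟨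
      (suc s ^ c) ^ k * K ^ k   ≡⟨ ^-distribʳ-* (suc s ^ c) K k ⟨
      (suc s ^ c * K) ^ k       ≤⟨ ^-monoˡ-≤ k rate≤ ⟩
      (s ^ c * suc K) ^ k       ≡⟨ ^-distribʳ-* (s ^ c) (suc K) k ⟩
      (s ^ c) ^ k * suc K ^ k   ≡⟨ cong (_* suc K ^ k) (^-*-assoc s c k) ⟩
      s ^ (c * k) * suc K ^ k   ∎

    -- Passing from the exponent `c * k` to `c * k + r` costs a factor ((s+1)/s)^r. It is bounded
    -- crudely by the integer `suc s ^ c`, which becomes the constant C.
    slowed-decay : ∀ b t k r → r ≤ c → b * suc K ^ k ≤ K ^ k * t →
                   b * suc s ^ (c * k + r) ≤ suc s ^ c * (t * s ^ (c * k + r))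
    slowed-decay b t k r r≤c decay = begin
      b * suc s ^ (c * k + r)                    ≡⟨ cong (b *_) (^-distribˡ-+-* (suc s) (c * k) r) ⟩
      b * (suc s ^ (c * k) * suc s ^ r)          ≡⟨ *-assoc b _ _ ⟨
      b * suc s ^ (c * k) * suc s ^ r            ≤⟨ *-mono-≤ main (^-monoʳ-≤ (suc s) r≤c) ⟩
      t * s ^ (c * k) * suc s ^ c                ≤⟨ *-monoˡ-≤ (suc s ^ c) (m≤m*n (t * s ^ (c * k)) (s ^ r) {{m^n≢0 s r}}) ⟩
      t * s ^ (c * k) * s ^ r * suc s ^ c        ≡⟨ solve 4 (λ t x y z → t :* x :* y :* z := z :* (t :* (x :* y))) refl t (s ^ (c * k)) (s ^ r) (suc s ^ c) ⟩
      suc s ^ c * (t * (s ^ (c * k) * s ^ r))    ≡⟨ cong (λ x → suc s ^ c * (t * x)) (^-distribˡ-+-* s (c * k) r) ⟨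
      suc s ^ c * (t * s ^ (c * k + r))          ∎
      where
      main : b * suc s ^ (c * k) ≤ t * s ^ (c * k)
      main = *-cancelʳ-≤ _ _ (suc K ^ k) {{m^n≢0 (suc K) k}} (begin
        b * suc s ^ (c * k) * suc K ^ k     ≡⟨ solve 3 (λ b x y → b :* x :* y := x :* (b :* y)) refl b (suc s ^ (c * k)) (suc K ^ k) ⟩
        suc s ^ (c * k) * (b * suc K ^ k)   ≤⟨ *-monoʳ-≤ (suc s ^ (c * k)) decay ⟩
        suc s ^ (c * k) * (K ^ k * t)       ≡⟨ *-assoc (suc s ^ (c * k)) (K ^ k) t ⟨
        suc s ^ (c * k) * K ^ k * t         ≤⟨ *-monoˡ-≤ t (rate-power k) ⟩
        s ^ (c * k) * suc K ^ k * t         ≡⟨ solve 3 (λ t x y → x :* y :* t := t :* x :* y) refl t (s ^ (c * k)) (suc K ^ k) ⟩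
        t * s ^ (c * k) * suc K ^ k         ∎)

  module _ (c l : ℕ) .{{_ : NonZero c}} where

    -- The length bound is `suc l`, yet `l` is what gets divided: the remainder then lies between 1
    -- and `c`, so `c * (l / c)` is strictly below the length bound.
    [l/c]c+r≡1+l : c * (l / c) + suc (l % c) ≡ suc l
    [l/c]c+r≡1+l = trans (+-suc (c * (l / c)) (l % c)) (cong suc (trans (+-comm (c * (l / c)) (l % c))
      (trans (cong (l % c +_) (*-comm c (l / c))) (sym (m≡m%n+[m/n]*n l c)))))

    4n[l/c]<1+l : ∀ n → c ≡ n * 4 → n * (l / c + l / c + (l / c + l / c)) < suc l
    4n[l/c]<1+l n c≡ = begin-strict
      n * (N + N + (N + N)) ≡⟨ solve 2 (λ n N → n :* (N :+ N :+ (N :+ N)) := n :* con 4 :* N) refl n N ⟩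
      n * 4 * N             ≡⟨ cong (_* N) c≡ ⟨
      c * N                 <⟨ m<m+n (c * N) (s≤s z≤n) ⟩
      c * N + suc (l % c)   ≡⟨ [l/c]c+r≡1+l ⟩
      suc l                 ∎
      where
      open ≤-Reasoning
      N : ℕ
      N = l / c

    union-bound : ∀ K m t g b .{{_ : NonZero m}} → t ≤ g + b →
                  b * suc K ^ (l / c) ≤ m * (K ^ (l / c) * t) → let s = c * suc K in
                  t * suc s ^ suc l ≤ g * suc s ^ suc l + suc s ^ c * m ^ 3 * s ^ suc l * t
    union-bound K m t g b t≤g+b decay = begin
      t * D                 ≤⟨ *-monoˡ-≤ D t≤g+b ⟩
      (g + b) * D           ≡⟨ *-distribʳ-+ D g b ⟩
      g * D + b * D         ≤⟨ +-monoʳ-≤ (g * D) bad ⟩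
      g * D + C * m ^ 3 * E * t ∎
      where
      open ≤-Reasoning
      N s C D E : ℕ
      N = l / c
      s = c * suc K
      C = suc s ^ c
      D = suc s ^ suc l
      E = s ^ suc l

      decay′ : b * suc K ^ N ≤ K ^ N * (m * t)
      decay′ = ≤-trans decay (≤-reflexive (solve 3 (λ m k t → m :* (k :* t) := k :* (m :* t)) refl m (K ^ N) t))

      bad : b * D ≤ C * m ^ 3 * E * t
      bad = begin
        b * D               ≤⟨ subst (λ ℓ → b * suc s ^ ℓ ≤ C * (m * t * s ^ ℓ)) [l/c]c+r≡1+l
                                 (slowed-decay c K s {{m*n≢0 c (suc K)}} (rate c K) b (m * t) N (suc (l % c)) (m%n<n l c) decay′) ⟩
        -- The union over starting levels contributes one factor `m`, enlarged here to the `m ^ 3`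
        -- of the statement.
        C * (m * t * E)     ≤⟨ *-monoʳ-≤ C (*-monoˡ-≤ E (*-monoˡ-≤ t (m≤m*n m (m ^ 2) {{m^n≢0 m 2}}))) ⟩
        C * (m ^ 3 * t * E) ≡⟨ solve 4 (λ C M t E → C :* (M :* t :* E) := C :* M :* E :* t) refl C (m ^ 3) t E ⟩
        C * m ^ 3 * E * t   ∎

-- Transfer from natural numbers to rational probabilities.

module Rationals where
  import Data.Integer.Base as ℤ
  open ℤ using (+_)
  import Data.Integer.Properties as ℤ
  open import Data.Rational.Base
    using (ℚ; 0ℚ; 1ℚ; _<_; _≤_; _≥_; _+_; _-_; -_; _*_; _/_; +-*-rawSemiring; toℚᵘ; Positive)
  import Data.Rational.Properties as ℚ
  open import Data.Rational.Solver using (module +-*-Solver)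
  open import Data.Rational.Unnormalised.Base as ℚᵘ using (mkℚᵘ; *≡*; *≤*; *<*)
  import Data.Rational.Unnormalised.Properties as ℚᵘ
  open import Algebra.Definitions.RawSemiring +-*-rawSemiring using (_^_)
  open Counting using (count)

  ι : ℕ → ℚ
  ι k = + k / 1

  toℚᵘ-/ : ∀ a d → toℚᵘ (+ a / suc d) ℚᵘ.≃ mkℚᵘ (+ a) d
  toℚᵘ-/ a d = ℚ.toℚᵘ-fromℚᵘ (mkℚᵘ (+ a) d)

  ι-+ : ∀ a b → ι (a ℕ.+ b) ≡ ι a + ι b
  ι-+ a b = ℚ.toℚᵘ-injective (begin-equality
    toℚᵘ (ι (a ℕ.+ b))            ≃⟨ toℚᵘ-/ (a ℕ.+ b) 0 ⟩
    mkℚᵘ (+ (a ℕ.+ b)) 0          ≃⟨ *≡* (cong (ℤ._* + 1) (sym (cong₂ ℤ._+_ (ℤ.*-identityʳ (+ a)) (ℤ.*-identityʳ (+ b))))) ⟩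
    mkℚᵘ (+ a) 0 ℚᵘ.+ mkℚᵘ (+ b) 0 ≃⟨ ℚᵘ.+-cong (toℚᵘ-/ a 0) (toℚᵘ-/ b 0) ⟨
    toℚᵘ (ι a) ℚᵘ.+ toℚᵘ (ι b)    ≃⟨ ℚ.toℚᵘ-homo-+ (ι a) (ι b) ⟨
    toℚᵘ (ι a + ι b)              ∎)
    where open ℚᵘ.≤-Reasoning

  /-*-ι : ∀ a d b c → a ℕ.* b ≡ c ℕ.* suc d → (+ a / suc d) * ι b ≡ ι c
  /-*-ι a d b c ab≡cd = ℚ.toℚᵘ-injective (begin-equality
    toℚᵘ ((+ a / suc d) * ι b)         ≃⟨ ℚ.toℚᵘ-homo-* (+ a / suc d) (ι b) ⟩
    toℚᵘ (+ a / suc d) ℚᵘ.* toℚᵘ (ι b) ≃⟨ ℚᵘ.*-cong (toℚᵘ-/ a d) (toℚᵘ-/ b 0) ⟩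
    mkℚᵘ (+ a) d ℚᵘ.* mkℚᵘ (+ b) 0     ≃⟨ *≡* (trans (ℤ.*-identityʳ _) (trans (sym (ℤ.pos-* a b)) (trans (cong +_ (trans ab≡cd (cong (c ℕ.*_) (sym (ℕ.*-identityʳ (suc d)))))) (ℤ.pos-* c (suc d ℕ.* 1))))) ⟩
    mkℚᵘ (+ c) 0                       ≃⟨ toℚᵘ-/ c 0 ⟨
    toℚᵘ (ι c)                         ∎)
    where open ℚᵘ.≤-Reasoning

  ι-* : ∀ a b → ι (a ℕ.* b) ≡ ι a * ι b
  ι-* a b = sym (/-*-ι a 0 b (a ℕ.* b) (sym (ℕ.*-identityʳ _)))

  /-*-cancel : ∀ a d → (+ a / suc d) * ι (suc d) ≡ ι a
  /-*-cancel a d = /-*-ι a d (suc d) a refl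

  ι-mono-≤ : ∀ {a b} → a ℕ.≤ b → ι a ≤ ι b
  ι-mono-≤ {a} {b} a≤b = ℚ.toℚᵘ-cancel-≤ (begin
    toℚᵘ (ι a)   ≃⟨ toℚᵘ-/ a 0 ⟩
    mkℚᵘ (+ a) 0 ≤⟨ *≤* (ℤ.*-monoʳ-≤-nonNeg (+ 1) (ℤ.+≤+ a≤b)) ⟩
    mkℚᵘ (+ b) 0 ≃⟨ toℚᵘ-/ b 0 ⟨
    toℚᵘ (ι b)   ∎)
    where open ℚᵘ.≤-Reasoning

  ι-mono-< : ∀ {a b} → a ℕ.< b → ι a < ι b
  ι-mono-< {a} {b} a<b = ℚ.toℚᵘ-cancel-< (begin-strict
    toℚᵘ (ι a)   ≃⟨ toℚᵘ-/ a 0 ⟩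
    mkℚᵘ (+ a) 0 <⟨ *<* (ℤ.*-monoʳ-<-pos (+ 1) (ℤ.+<+ a<b)) ⟩
    mkℚᵘ (+ b) 0 ≃⟨ toℚᵘ-/ b 0 ⟨
    toℚᵘ (ι b)   ∎)
    where open ℚᵘ.≤-Reasoning

  ι-pos : ∀ k → Positive (ι (suc k))
  ι-pos k = ℚ.normalize-pos (suc k) 1

  ι-^ : ∀ a k → ι (a ℕ.^ k) ≡ ι a ^ k
  ι-^ a zero    = refl
  ι-^ a (suc k) = trans (ι-* a (a ℕ.^ k)) (cong (ι a *_) (ι-^ a k))

  /-^-cancel : ∀ a d k → (+ a / suc d) ^ k * ι (suc d ℕ.^ k) ≡ ι (a ℕ.^ k)
  /-^-cancel a d zero    = refl
  /-^-cancel a d (suc k) = begin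
    θ * θ ^ k * ι (suc d ℕ.* suc d ℕ.^ k)         ≡⟨ cong (θ * θ ^ k *_) (ι-* (suc d) (suc d ℕ.^ k)) ⟩
    θ * θ ^ k * (ι (suc d) * ι (suc d ℕ.^ k))     ≡⟨ solve 4 (λ x y z w → x :* y :* (z :* w) := x :* z :* (y :* w)) refl θ (θ ^ k) (ι (suc d)) (ι (suc d ℕ.^ k)) ⟩
    θ * ι (suc d) * (θ ^ k * ι (suc d ℕ.^ k))     ≡⟨ cong₂ _*_ (/-*-cancel a d) (/-^-cancel a d k) ⟩
    ι a * ι (a ℕ.^ k)                             ≡⟨ ι-* a (a ℕ.^ k) ⟨
    ι (a ℕ.* a ℕ.^ k)                             ∎
    where
    open ≡-Reasoning
    open +-*-Solver
    θ : ℚ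
    θ = + a / suc d

  0<s/1+s : ∀ s .{{_ : ℕ.NonZero s}} → 0ℚ < + s / suc s
  0<s/1+s s = ℚ.positive⁻¹ (+ s / suc s) {{ℚ.normalize-pos s (suc s)}}

  s/1+s<1 : ∀ s → + s / suc s < 1ℚ
  s/1+s<1 s = ℚ.*-cancelʳ-<-nonNeg (ι (suc s)) {{ℚ.pos⇒nonNeg (ι (suc s)) {{ι-pos s}}}}
    (subst₂ _<_ (sym (/-*-cancel s s)) (sym (ℚ.*-identityˡ (ι (suc s)))) (ι-mono-< (ℕ.n<1+n s)))

  -- A member of `xs` guarantees that `Pr` is a genuine quotient and not its default value 0 on the
  -- empty list. The claim is then the hypothesis divided by `length xs * suc s ^ ℓ`.
  Pr-≥ : {A : Set} {P : Pred A 0ℓ} (P? : Decidable P) {x : A} {xs : List A} → x ∈ xs → ∀ C m s ℓ →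
         length xs ℕ.* suc s ℕ.^ ℓ ℕ.≤ count P? xs ℕ.* suc s ℕ.^ ℓ ℕ.+ C ℕ.* m ℕ.^ 3 ℕ.* s ℕ.^ ℓ ℕ.* length xs →
         Pr xs P? ≥ 1ℚ - (+ C / 1) * (+ m / 1) ^ 3 * (+ s / suc s) ^ ℓ
  Pr-≥ P? {xs = xs@(_ ∷ ys)} _ C m s ℓ bound = begin
    1ℚ - X           ≤⟨ ℚ.+-monoˡ-≤ (- X) 1≤ ⟩
    y + X - X        ≡⟨ solve 2 (λ y X → y :+ X :- X := y) refl y X ⟩
    y                ∎
    where
    open ℚ.≤-Reasoning
    open +-*-Solver
    t g D E : ℕ
    t = length xs
    g = count P? xs
    D = suc s ℕ.^ ℓ
    E = s ℕ.^ ℓ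

    θ M X y : ℚ
    θ = (+ s / suc s) ^ ℓ
    M = ι m ^ 3
    X = ι C * M * θ
    y = + g / t

    instance
      tD≢0 : ℕ.NonZero (t ℕ.* D)
      tD≢0 = ℕ.m*n≢0 t D {{_}} {{ℕ.m^n≢0 (suc s) ℓ}}

    1≤ : 1ℚ ≤ y + X
    1≤ = ℚ.*-cancelʳ-≤-pos (ι (t ℕ.* D)) {{ℚ.normalize-pos (t ℕ.* D) 1}} (begin
      1ℚ * ι (t ℕ.* D)                                     ≡⟨ ℚ.*-identityˡ _ ⟩
      ι (t ℕ.* D)                                          ≤⟨ ι-mono-≤ bound ⟩
      ι (g ℕ.* D ℕ.+ C ℕ.* m ℕ.^ 3 ℕ.* E ℕ.* t)            ≡⟨ ι-+ (g ℕ.* D) _ ⟩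
      ι (g ℕ.* D) + ι (C ℕ.* m ℕ.^ 3 ℕ.* E ℕ.* t)          ≡⟨ cong₂ _+_ left right ⟩
      y * ι t * ι D + ι C * M * (θ * ι D) * ι t            ≡⟨ solve 6 (λ y t D C M θ → y :* t :* D :+ C :* M :* (θ :* D) :* t := (y :+ C :* M :* θ) :* (t :* D)) refl y (ι t) (ι D) (ι C) M θ ⟩
      (y + X) * (ι t * ι D)                                ≡⟨ cong ((y + X) *_) (ι-* t D) ⟨
      (y + X) * ι (t ℕ.* D)                                ∎)
      where
      left : ι (g ℕ.* D) ≡ y * ι t * ι D
      left = trans (ι-* g D) (cong (_* ι D) (sym (/-*-cancel g (length ys))))

      right : ι (C ℕ.* m ℕ.^ 3 ℕ.* E ℕ.* t) ≡ ι C * M * (θ * ι D) * ι t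
      right = trans (ι-* (C ℕ.* m ℕ.^ 3 ℕ.* E) t) (cong (_* ι t)
        (trans (ι-* (C ℕ.* m ℕ.^ 3) E) (cong₂ _*_
          (trans (ι-* C (m ℕ.^ 3)) (cong (ι C *_) (ι-^ m 3))) (sym (/-^-cancel s s ℓ)))))

-- The constants and the final estimate.

open import Data.Integer.Base using (+_)
open import Data.Rational.Base using (ℚ; 0ℚ; 1ℚ; _<_; _≥_; _-_; _*_; _/_; +-*-rawSemiring)
open import Algebra.Definitions.RawSemiring +-*-rawSemiring using (_^_)
open Counting using (count)
open Arithmetic using (union-bound; 4n[l/c]<1+l)
open Cylinders using (tree-exists; few-long-branches)
open Rationals using (0<s/1+s; s/1+s<1; Pr-≥)

theorem2 : (n : ℕ) → n ≥ℕ 3 →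
    ∃ λ (C : ℚ) → ∃ λ (θ : ℚ) → (0ℚ < θ × θ < 1ℚ) ×
    ((m : ℕ) → m ≥ℕ 2 → (ℓ : ℕ) → ℓ ≥ℕ 1 →
    Pr (spanningTrees (wiredCylinder n m))
    (λ T → hasSinkTrunkWithBranchesShorterThan? n m T ℓ)
    ≥ 1ℚ - C * (+ m / 1) ^ 3 * θ ^ ℓ)
theorem2 n n≥3 = + (suc s ℕ.^ c) / 1 , + s / suc s , (0<s/1+s s , s/1+s<1 s) , bound
  where
  instance
    n≢0 : ℕ.NonZero n
    n≢0 = ℕ.>-nonZero (ℕ.≤-trans (s≤s z≤n) n≥3)

  -- A branch gains at most `c` in length for each level of a run, and `K` bounds how many trees
  -- become equal under narrowing. By `rate`, this `s` makes the c-th power of s / (s + 1) at least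
  -- K / (K + 1).
  c K s : ℕ
  c = n ℕ.* 4
  K = 2 ℕ.^ (n ℕ.+ (n ℕ.+ n))
  s = c ℕ.* suc K

  instance
    c≢0 : ℕ.NonZero c
    c≢0 = ℕ.m*n≢0 n 4

    s≢0 : ℕ.NonZero s
    s≢0 = ℕ.m*n≢0 c (suc K)

  bound : ∀ m → m ≥ℕ 2 → ∀ ℓ → ℓ ≥ℕ 1 →
    Pr (spanningTrees (wiredCylinder n m)) (λ T → hasSinkTrunkWithBranchesShorterThan? n m T ℓ)
      ≥ 1ℚ - (+ (suc s ℕ.^ c) / 1) * (+ m / 1) ^ 3 * (+ s / suc s) ^ ℓ
  bound m m≥2 (suc l) _ =
    let b , t≤g+b , decay = few-long-branches n m n≥3 m≥2 (l ℕ./ c) (suc l) (4n[l/c]<1+l c l n refl) in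
    Pr-≥ (λ T → hasSinkTrunkWithBranchesShorterThan? n m T (suc l))
      (proj₂ (tree-exists n m n≥3 m≥2)) (suc s ℕ.^ c) m s (suc l)
      (union-bound c l K m (length (spanningTrees (wiredCylinder n m)))
        (count (λ T → hasSinkTrunkWithBranchesShorterThan? n m T (suc l)) (spanningTrees (wiredCylinder n m)))
        b {{ℕ.>-nonZero (ℕ.≤-trans (s≤s z≤n) m≥2)}} t≤g+b decay)
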